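{- Let $G$ be a finite, simple, $2$-edge-connected, claw-free cubic graph with $n(G)=|V(G)|$ vertices. If $G$ is not a ring of diamonds, then $Z_{\dot{\ell}}(G)\le Z(G)\le \left\lceil \frac{5n(G)}{18}\right\rceil+1$. If $G$ is a ring of diamonds, then $Z_{\dot{\ell}}(G)=Z(G)=\frac{n(G)}{4}+2$.
   Context: Zero forcing: given $S\subseteq V(G)$, color the vertices of $S$ blue and all others white; repeatedly apply the rule "if $w$ is the only white neighbor of a blue vertex $v$, color $w$ blue". $S$ is a zero forcing set if eventually all vertices are blue; $Z(G)$ is the minimum size of a zero forcing set. Loop zero forcing (for connected simple graphs): same process, but the rule is "color $w$ blue if either $w$ is the only white neighbor of some blue vertex $v$, or every neighbor of $w$ is blue"; $Z_{\dot{\ell}}(G)$ is the minimum size of a set from which this process turns all vertices blue. A graph is claw-free if it has no induced $K_{1,3}$. A diamond is the graph obtained from $K_4$ by deleting one edge; it has exactly two vertices of degree $2$. A ring of diamonds is a cubic graph obtained from $k\ge 2$ vertex-disjoint diamonds $D_1,\dots,D_k$ by joining, for each $i\in[k]$ (indices mod $k$), one degree-$2$ vertex of $D_i$ to one degree-$2$ vertex of $D_{i+1}$, so that each degree-$2$ vertex of each diamond receives exactly one such new edge. -}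

module Defs where

open import Data.Nat using (ℕ; zero; suc; _+_; _*_; _∸_; _≤_; NonZero)
open import Data.Nat.DivMod using (_/_; _%_)
open import Data.Bool using (Bool; true; false)
open import Data.Fin using (Fin; toℕ)
open import Data.Fin.Subset using (Subset; _∈_; ∣_∣)
open import Data.Vec using (tabulate)
open import Data.Product using (Σ; _×_; _,_)
open import Data.Sum using (_⊎_)
open import Relation.Nullary using (¬_)
open import Relation.Binary.PropositionalEquality using (_≡_; _≢_)
open import Relation.Binary.Construct.Closure.ReflexiveTransitive using (Star)
open import Function.Bundles using (_↔_; Inverse)

record Graph : Set where
  field
    n      : ℕ
    adj    : Fin n → Fin n → Bool
    sym    : ∀ u v → adj u v ≡ adj v u
    irrefl : ∀ v → adj v v ≡ false

module _ (G : Graph) where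
  open Graph G

  Adj : Fin n → Fin n → Set
  Adj u v = adj u v ≡ true

  N : Fin n → Subset n
  N v = tabulate (adj v)

  deg : Fin n → ℕ
  deg v = ∣ N v ∣

  Cubic : Set
  Cubic = ∀ v → deg v ≡ 3

  ConnectedBy : (Fin n → Fin n → Set) → Set
  ConnectedBy E = ∀ u v → Star E u v

  Connected : Set
  Connected = ConnectedBy Adj

  AdjMinus : Fin n → Fin n → Fin n → Fin n → Set
  AdjMinus u v x y = Adj x y × ¬ (x ≡ u × y ≡ v) × ¬ (x ≡ v × y ≡ u)

  TwoEdgeConnected : Set
  TwoEdgeConnected = Connected × (∀ u v → Adj u v → ConnectedBy (AdjMinus u v))

  ClawFree : Set
  ClawFree = ∀ v a b c → Adj v a → Adj v b → Adj v c →
             a ≢ b → a ≢ c → b ≢ c → Adj a b ⊎ Adj a c ⊎ Adj b c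

  -- Vertices eventually coloured blue by the zero forcing process started from S
  -- (least set containing S closed under the colour change rule).
  data Forced (S : Subset n) : Fin n → Set where
    init  : ∀ {v} → v ∈ S → Forced S v
    force : ∀ {u w} → Forced S u → Adj u w →
            (∀ x → Adj u x → x ≢ w → Forced S x) → Forced S w

  data LForced (S : Subset n) : Fin n → Set where
    init  : ∀ {v} → v ∈ S → LForced S v
    force : ∀ {u w} → LForced S u → Adj u w →
            (∀ x → Adj u x → x ≢ w → LForced S x) → LForced S w
    loop  : ∀ {w} → (∀ x → Adj w x → LForced S x) → LForced S w

  IsZFS : Subset n → Set
  IsZFS S = ∀ v → Forced S v

  IsLZFS : Subset n → Set
  IsLZFS S = ∀ v → LForced S v

  IsZ : ℕ → Set
  IsZ k = Σ (Subset n) (λ S → ∣ S ∣ ≡ k × IsZFS S) × (∀ S → IsZFS S → k ≤ ∣ S ∣)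

  IsZl : ℕ → Set
  IsZl k = Σ (Subset n) (λ S → ∣ S ∣ ≡ k × IsLZFS S) × (∀ S → IsLZFS S → k ≤ ∣ S ∣)

-- Ring of k diamonds on vertex set Fin k × Fin 4: in diamond i, vertices 0 and 1 are the
-- degree-2 vertices (non-adjacent), all other pairs adjacent; vertex (i,1) is joined to
-- vertex (i+1 mod k, 0).
DiamondEdge : Fin 4 → Fin 4 → Set
DiamondEdge a b = a ≢ b × ¬ (toℕ a ≡ 0 × toℕ b ≡ 1) × ¬ (toℕ a ≡ 1 × toℕ b ≡ 0)

RingLink : (k : ℕ) .{{_ : NonZero k}} → Fin k × Fin 4 → Fin k × Fin 4 → Set
RingLink k (i , a) (j , b) = toℕ j ≡ suc (toℕ i) % k × toℕ a ≡ 1 × toℕ b ≡ 0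

RingAdj : (k : ℕ) .{{_ : NonZero k}} → Fin k × Fin 4 → Fin k × Fin 4 → Set
RingAdj k (i , a) (j , b) =
  (i ≡ j × DiamondEdge a b) ⊎ RingLink k (i , a) (j , b) ⊎ RingLink k (j , b) (i , a)

RingOfDiamonds : Graph → Set
RingOfDiamonds G =
  Σ ℕ λ m → Σ (Fin (Graph.n G) ↔ (Fin (2 + m) × Fin 4)) λ φ →
    ∀ u v → (Adj G u v → RingAdj (2 + m) (Inverse.to φ u) (Inverse.to φ v))
          × (RingAdj (2 + m) (Inverse.to φ u) (Inverse.to φ v) → Adj G u v)

⌈_/_⌉ : ℕ → (d : ℕ) .{{_ : NonZero d}} → ℕ
⌈ a / d ⌉ = (a + (d ∸ 1)) / d

{-# OPTIONS --safe #-}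
-- By claw-freeness every vertex lies in a triangle, so unless G is K₄ its vertices split into
-- "units": diamonds, and triangles with three distinct outer neighbours.  Completing one unit after
-- another keeps 4|S| + I(X) ≤ 4|X| + 6, where X is the union of the completed units and I(X) is
-- twice the number of edges inside X: a first triangle or diamond costs 3 vertices of S, a diamond
-- or triangle with one edge to X costs 1, and a triangle with two or three edges to X costs 0.
-- The only bad step is a diamond with both ends attached to X.  It is avoided by adding attached
-- diamonds before any further triangle: then it could only close up the part grown from the last
-- triangle, leaving at most one edge out of that part; as G has no bridge, no vertex is left, and
-- the loss is 2.  For X = V this gives 4 Z(G) ≤ n + 8, which implies both upper bounds.
--
-- In a ring of k diamonds the two middle vertices of a diamond are twins, so one of them lies in
-- S.  If |S| ≤ k + 1, at most one further vertex is in S, and then no rule applies at all.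
module Submission where

open import Defs
open import Data.Nat using (ℕ; zero; suc; _+_; _*_; _≤_; _<_; z≤n; s≤s; _≤?_)
open import Data.Nat.Properties
  using ( ≤-refl; ≤-reflexive; ≤-trans; ≤-antisym; <-irrefl; <⇒≱; <⇒≢; ≮⇒≥; m≤n⇒m<n∨m≡n; n<1+n; n≤1+n
        ; +-suc; +-comm; +-assoc; +-identityʳ; +-mono-≤; +-monoˡ-≤; +-monoʳ-≤; +-cancelʳ-≤; m≤m+n; m≤n+m
        ; *-suc; *-distribˡ-+; *-mono-≤; *-monoʳ-≤; *-cancelˡ-≤; suc-injective; _≟_; module ≤-Reasoning )
open import Data.Nat.DivMod using (_/_; _%_; m%n<n; n%n≡0; m<n⇒m%n≡m; m*n/n≡m; /-monoˡ-≤)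
open import Data.Nat.Tactic.RingSolver using (solve-∀)
open import Data.Bool using (Bool; true; false)
open import Data.Bool.Properties using (¬-not)
open import Data.Fin using (Fin; zero; suc; toℕ; fromℕ; fromℕ<; inject₁)
open import Data.Fin.Patterns using (0F; 1F; 2F; 3F)
open import Data.Fin.Permutation using (↔⇒≡)
import Data.Fin.Properties as Fin
open import Data.Fin.Subset using (Subset; _∈_; ∣_∣; _∪_; ⁅_⁆; _⊆_; ⊤)
open import Data.Fin.Subset.Properties
  using (p⊆p∪q; q⊆p∪q; x∈⁅x⁆; ∣⁅x⁆∣≡1; ∈⊤; ∣⊤∣≡n; x∈p⇒∣p-x∣<∣p∣; x∈p∧x≢y⇒x∈p-y)
  renaming (_∈?_ to _∈ˢ?_)
open import Data.Vec using ([]; _∷_; here; there)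
open import Data.Vec.Properties using (lookup∘tabulate; lookup⇒[]=; []=⇒lookup)
open import Data.List using (List; []; _∷_; _++_; map; length; tabulate)
open import Data.List.Properties using (length-map; length-tabulate)
open import Data.List.Membership.Propositional using () renaming (_∈_ to _∈ₗ_; _∉_ to _∉ₗ_)
open import Data.List.Membership.Propositional.Properties using (∈-map⁺; ∈-++⁻; ∈-++⁺ˡ; ∈-++⁺ʳ)
open import Data.List.Relation.Unary.Any using (here; there)
open import Data.List.Relation.Unary.All as All using (All; []; _∷_)
import Data.List.Relation.Unary.All.Properties as Allₚ
open import Data.List.Relation.Unary.AllPairs using ([]; _∷_)
open import Data.List.Relation.Unary.Unique.Propositional using (Unique)
import Data.List.Relation.Unary.Unique.Propositional.Properties as Uniqueₚ
open import Data.Product using (∃; ∃-syntax; _×_; _,_; proj₁; proj₂)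
open import Data.Product.Properties using (≡-dec)
open import Data.Sum using (_⊎_; inj₁; inj₂; [_,_])
open import Data.Empty using (⊥; ⊥-elim)
open import Data.Unit using (tt)
open import Relation.Nullary using (Dec; ¬_; yes; no)
open import Relation.Nullary.Decidable using (True; toWitness; ¬?; _×-dec_)
open import Relation.Binary.PropositionalEquality
  using (_≡_; _≢_; refl; sym; trans; cong; cong₂; subst; subst₂; ≢-sym; module ≡-Reasoning)
open import Relation.Binary.Construct.Closure.ReflexiveTransitive using (Star; ε; _◅_)
open import Function using (_∘_; id)
open import Function.Bundles using (_↔_; Inverse)
open import Function.Construct.Composition using (_↔-∘_)
open import Function.Construct.Symmetry using (↔-sym)

-- Finite subsets and duplicate-free lists.

∣p∪q∣≤∣p∣+∣q∣ : ∀ {n} (p q : Subset n) → ∣ p ∪ q ∣ ≤ ∣ p ∣ + ∣ q ∣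
∣p∪q∣≤∣p∣+∣q∣ []          []          = z≤n
∣p∪q∣≤∣p∣+∣q∣ (true  ∷ p) (true  ∷ q) =
  s≤s (≤-trans (∣p∪q∣≤∣p∣+∣q∣ p q) (+-monoʳ-≤ ∣ p ∣ (n≤1+n _)))
∣p∪q∣≤∣p∣+∣q∣ (true  ∷ p) (false ∷ q) = s≤s (∣p∪q∣≤∣p∣+∣q∣ p q)
∣p∪q∣≤∣p∣+∣q∣ (false ∷ p) (true  ∷ q) =
  ≤-trans (s≤s (∣p∪q∣≤∣p∣+∣q∣ p q)) (≤-reflexive (sym (+-suc ∣ p ∣ ∣ q ∣)))
∣p∪q∣≤∣p∣+∣q∣ (false ∷ p) (false ∷ q) = ∣p∪q∣≤∣p∣+∣q∣ p q

∣p∪⁅x⁆∣≤∣p∣+1 : ∀ {n} (p : Subset n) x → ∣ p ∪ ⁅ x ⁆ ∣ ≤ ∣ p ∣ + 1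
∣p∪⁅x⁆∣≤∣p∣+1 p x = subst (λ k → ∣ p ∪ ⁅ x ⁆ ∣ ≤ ∣ p ∣ + k) (∣⁅x⁆∣≡1 x) (∣p∪q∣≤∣p∣+∣q∣ p ⁅ x ⁆)

elements : ∀ {n} → Subset n → List (Fin n)
elements []          = []
elements (true  ∷ p) = zero ∷ map suc (elements p)
elements (false ∷ p) = map suc (elements p)

length-elements : ∀ {n} (p : Subset n) → length (elements p) ≡ ∣ p ∣
length-elements []          = refl
length-elements (true  ∷ p) = cong suc (trans (length-map suc (elements p)) (length-elements p))
length-elements (false ∷ p) = trans (length-map suc (elements p)) (length-elements p)

∈-elements⁺ : ∀ {n} {p : Subset n} {x} → x ∈ p → x ∈ₗ elements p
∈-elements⁺ {p = true  ∷ p} here        = here refl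
∈-elements⁺ {p = true  ∷ p} (there x∈p) = there (∈-map⁺ suc (∈-elements⁺ x∈p))
∈-elements⁺ {p = false ∷ p} (there x∈p) = ∈-map⁺ suc (∈-elements⁺ x∈p)

elements-⊆ : ∀ {n} (p : Subset n) → All (_∈ p) (elements p)
elements-⊆ []          = []
elements-⊆ (true  ∷ p) = here ∷ Allₚ.map⁺ (All.map there (elements-⊆ p))
elements-⊆ (false ∷ p) = Allₚ.map⁺ (All.map there (elements-⊆ p))

elements-unique : ∀ {n} (p : Subset n) → Unique (elements p)
elements-unique []          = []
elements-unique (true  ∷ p) =
  Allₚ.map⁺ (All.universal (λ _ ()) (elements p)) ∷ Uniqueₚ.map⁺ Fin.suc-injective (elements-unique p)
elements-unique (false ∷ p) = Uniqueₚ.map⁺ Fin.suc-injective (elements-unique p)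

unique⇒length≤∣p∣ : ∀ {n} {xs : List (Fin n)} {p : Subset n} →
                    Unique xs → All (_∈ p) xs → length xs ≤ ∣ p ∣
unique⇒length≤∣p∣ []          []          = z≤n
unique⇒length≤∣p∣ (x∉xs ∷ xs!) (x∈p ∷ xs⊆p) =
  ≤-trans (s≤s (unique⇒length≤∣p∣ xs! (All.zipWith (λ (x≢y , y∈p) → x∈p∧x≢y⇒x∈p-y y∈p (≢-sym x≢y)) (x∉xs , xs⊆p))))
          (x∈p⇒∣p-x∣<∣p∣ x∈p)

unique⇒length≤n : ∀ {n} {xs : List (Fin n)} → Unique xs → length xs ≤ n
unique⇒length≤n {n} {xs} xs! =
  subst (length xs ≤_) (∣⊤∣≡n n) (unique⇒length≤∣p∣ xs! (All.universal (λ _ → ∈⊤) xs))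

unique-++⁻ˡ : ∀ {A : Set} (xs : List A) {ys} → Unique (xs ++ ys) → Unique xs
unique-++⁻ˡ []       _           = []
unique-++⁻ˡ (x ∷ xs) (x∉ ∷ xs!) = Allₚ.++⁻ˡ xs x∉ ∷ unique-++⁻ˡ xs xs!

∉⇒All≢ : ∀ {n} {x : Fin n} {xs} → x ∉ₗ xs → All (x ≢_) xs
∉⇒All≢ = Allₚ.¬Any⇒All¬ _

infixr 5 _∉∷_
_∉∷_ : ∀ {n} {x y : Fin n} {ys} → x ≢ y → x ∉ₗ ys → x ∉ₗ y ∷ ys
(x≢y ∉∷ x∉ys) (here x≡y)   = x≢y x≡y
(x≢y ∉∷ x∉ys) (there x∈ys) = x∉ys x∈ys

-- Neighbourhoods of size three, edge counts and forcing.

module Neighbourhoods (G : Graph) where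
  open Graph G renaming (sym to adj-sym)
  open import Data.List.Membership.DecPropositional (Fin._≟_ {n}) using (_∈?_)

  infix 4 _~_
  _~_ : Fin n → Fin n → Set
  _~_ = Adj G

  ~-sym : ∀ {u v} → u ~ v → v ~ u
  ~-sym {u} {v} = trans (adj-sym v u)

  ~⇒≢ : ∀ {u v} → u ~ v → u ≢ v
  ~⇒≢ {u} u~u refl with () ← trans (sym u~u) (irrefl u)

  -- The order of the names matters: the third place usually holds the neighbour outside the
  -- triangle under consideration, or the one about to be forced. `swap`, `rotate` and the `focus`
  -- lemmas rearrange them.
  record Nbr (v p q r : Fin n) : Set where
    field
      ~p   : v ~ p
      ~q   : v ~ q
      ~r   : v ~ r
      p≢q  : p ≢ q
      p≢r  : p ≢ r
      q≢r  : q ≢ r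
      only : ∀ {x} → v ~ x → x ≡ p ⊎ x ≡ q ⊎ x ≡ r

  swap : ∀ {v p q r} → Nbr v p q r → Nbr v q p r
  swap N = record { ~p = ~q; ~q = ~p; ~r = ~r; p≢q = ≢-sym p≢q; p≢r = q≢r; q≢r = p≢r
                  ; only = λ vx → [ inj₂ ∘ inj₁ , [ inj₁ , inj₂ ∘ inj₂ ] ] (only vx) }
    where open Nbr N

  rotate : ∀ {v p q r} → Nbr v p q r → Nbr v q r p
  rotate N = record { ~p = ~q; ~q = ~r; ~r = ~p; p≢q = q≢r; p≢r = ≢-sym p≢q; q≢r = ≢-sym p≢r
                    ; only = λ vx → [ inj₂ ∘ inj₂ , [ inj₁ , inj₂ ∘ inj₁ ] ] (only vx) }
    where open Nbr N

  focus : ∀ {v x y z} p → Nbr v x y z → v ~ p → ∃[ q ] ∃[ r ] Nbr v p q r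
  focus p N v~p with Nbr.only N v~p
  ... | inj₁ refl        = _ , _ , N
  ... | inj₂ (inj₁ refl) = _ , _ , rotate N
  ... | inj₂ (inj₂ refl) = _ , _ , rotate (rotate N)

  focus₂ : ∀ {v x y z} p q → Nbr v x y z → v ~ p → v ~ q → p ≢ q → ∃[ r ] Nbr v p q r
  focus₂ p q N v~p v~q p≢q with focus p N v~p
  ... | _ , _ , N′ with Nbr.only N′ v~q
  ...   | inj₁ refl        = ⊥-elim (p≢q refl)
  ...   | inj₂ (inj₁ refl) = _ , N′
  ...   | inj₂ (inj₂ refl) = _ , swap (rotate (rotate N′))

  focus₃ : ∀ {v x y z} p q r → Nbr v x y z → v ~ p → v ~ q → v ~ r → p ≢ q → p ≢ r → q ≢ r → Nbr v p q r
  focus₃ p q r N v~p v~q v~r p≢q p≢r q≢r with focus₂ p q N v~p v~q p≢q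
  ... | _ , N′ with Nbr.only N′ v~r
  ...   | inj₁ refl        = ⊥-elim (p≢r refl)
  ...   | inj₂ (inj₁ refl) = ⊥-elim (q≢r refl)
  ...   | inj₂ (inj₂ refl) = N′

  ∈N⇒~ : ∀ {v x} → x ∈ N G v → v ~ x
  ∈N⇒~ {v} {x} x∈ = trans (sym (lookup∘tabulate (adj v) x)) ([]=⇒lookup x∈)

  ~⇒∈N : ∀ {v x} → v ~ x → x ∈ N G v
  ~⇒∈N {v} {x} v~x = lookup⇒[]= x _ (trans (lookup∘tabulate (adj v) x) v~x)

  neighbours : Cubic G → ∀ v → ∃[ p ] ∃[ q ] ∃[ r ] Nbr v p q r
  neighbours cubic v = build (elements (N G v)) (trans (length-elements (N G v)) (cubic v))
                             (elements-unique (N G v)) (elements-⊆ (N G v)) ∈-elements⁺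
    where
    build : ∀ l → length l ≡ 3 → Unique l → All (_∈ N G v) l → (∀ {x} → x ∈ N G v → x ∈ₗ l) →
            ∃[ p ] ∃[ q ] ∃[ r ] Nbr v p q r
    build (p ∷ q ∷ r ∷ []) refl ((p≢q ∷ p≢r ∷ []) ∷ (q≢r ∷ []) ∷ _) (p∈ ∷ q∈ ∷ r∈ ∷ []) all =
      p , q , r , record { ~p = ∈N⇒~ p∈; ~q = ∈N⇒~ q∈; ~r = ∈N⇒~ r∈; p≢q = p≢q; p≢r = p≢r; q≢r = q≢r
                         ; only = λ v~x → three (all (~⇒∈N v~x)) }
      where
      three : ∀ {x} → x ∈ₗ p ∷ q ∷ r ∷ [] → x ≡ p ⊎ x ≡ q ⊎ x ≡ r
      three (here e)                 = inj₁ e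
      three (there (here e))         = inj₂ (inj₁ e)
      three (there (there (here e))) = inj₂ (inj₂ e)

  -- Counting adjacencies

  ⟦_⟧ : Bool → ℕ
  ⟦ true ⟧  = 1
  ⟦ false ⟧ = 0

  cnt : Fin n → List (Fin n) → ℕ
  cnt v []      = 0
  cnt v (x ∷ L) = ⟦ adj v x ⟧ + cnt v L

  -- For disjoint duplicate-free lists this is the number of edges between them; with both arguments
  -- equal, every inner edge is met twice.
  E : List (Fin n) → List (Fin n) → ℕ
  E []      X = 0
  E (u ∷ U) X = cnt u X + E U X

  cnt-++ : ∀ v X Y → cnt v (X ++ Y) ≡ cnt v X + cnt v Y
  cnt-++ v []      Y = refl
  cnt-++ v (x ∷ X) Y = trans (cong (⟦ adj v x ⟧ +_) (cnt-++ v X Y)) (sym (+-assoc ⟦ adj v x ⟧ _ _))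

  E-++ˡ : ∀ U V X → E (U ++ V) X ≡ E U X + E V X
  E-++ˡ []      V X = refl
  E-++ˡ (u ∷ U) V X = trans (cong (cnt u X +_) (E-++ˡ U V X)) (sym (+-assoc (cnt u X) _ _))

  interchange : ∀ a b c d → (a + b) + (c + d) ≡ (a + c) + (b + d)
  interchange = solve-∀

  E-++ʳ : ∀ U X Y → E U (X ++ Y) ≡ E U X + E U Y
  E-++ʳ []      X Y = refl
  E-++ʳ (u ∷ U) X Y = trans (cong₂ _+_ (cnt-++ u X Y) (E-++ʳ U X Y)) (interchange (cnt u X) _ _ _)

  E-∷ʳ : ∀ U x X → E U (x ∷ X) ≡ cnt x U + E U X
  E-∷ʳ []      x X = refl
  E-∷ʳ (u ∷ U) x X = trans (cong₂ _+_ (cong (λ b → ⟦ b ⟧ + cnt u X) (adj-sym u x)) (E-∷ʳ U x X))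
                           (interchange ⟦ adj x u ⟧ _ _ _)

  E-sym : ∀ U X → E U X ≡ E X U
  E-sym []      X = sym (E-[] X)
    where
    E-[] : ∀ X → E X [] ≡ 0
    E-[] []      = refl
    E-[] (x ∷ X) = E-[] X
  E-sym (u ∷ U) X = trans (cong (cnt u X +_) (E-sym U X)) (sym (E-∷ʳ X u U))

  I : List (Fin n) → ℕ
  I X = E X X

  I-++ : ∀ U X → I (U ++ X) ≡ (I U + (E U X + E U X)) + I X
  I-++ U X = begin
    E (U ++ X) (U ++ X)                   ≡⟨ E-++ˡ U X (U ++ X) ⟩
    E U (U ++ X) + E X (U ++ X)           ≡⟨ cong₂ _+_ (E-++ʳ U U X) (E-++ʳ X U X) ⟩
    (E U U + E U X) + (E X U + E X X)     ≡⟨ cong (λ e → (E U U + E U X) + (e + E X X)) (E-sym X U) ⟩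
    (E U U + E U X) + (E U X + E X X)     ≡⟨ regroup (E U U) (E U X) (E X X) ⟩
    (E U U + (E U X + E U X)) + E X X     ∎
    where
    open ≡-Reasoning
    regroup : ∀ a b c → (a + b) + (b + c) ≡ (a + (b + b)) + c
    regroup = solve-∀

  δ : Fin n → Fin n → ℕ
  δ p x with p Fin.≟ x
  ... | yes _ = 1
  ... | no  _ = 0

  δ-refl : ∀ p → δ p p ≡ 1
  δ-refl p with p Fin.≟ p
  ... | yes _  = refl
  ... | no p≢p = ⊥-elim (p≢p refl)

  δ-≢ : ∀ {p x} → p ≢ x → δ p x ≡ 0
  δ-≢ {p} {x} p≢x with p Fin.≟ x
  ... | yes p≡x = ⊥-elim (p≢x p≡x)
  ... | no _    = refl

  occ : Fin n → List (Fin n) → ℕ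
  occ p []      = 0
  occ p (x ∷ L) = δ p x + occ p L

  occ-∉ : ∀ {p} L → p ∉ₗ L → occ p L ≡ 0
  occ-∉ []      p∉ = refl
  occ-∉ (x ∷ L) p∉ = cong₂ _+_ (δ-≢ (p∉ ∘ here)) (occ-∉ L (p∉ ∘ there))

  occ-∈ : ∀ {p L} → p ∈ₗ L → 1 ≤ occ p L
  occ-∈ {p} (here refl)     = ≤-trans (≤-reflexive (sym (δ-refl p))) (m≤m+n _ _)
  occ-∈ {p} {x ∷ L} (there p∈) = ≤-trans (occ-∈ p∈) (m≤n+m _ (δ p x))

  occ≤1 : ∀ {p L} → Unique L → occ p L ≤ 1
  occ≤1 []          = z≤n
  occ≤1 {p} {x ∷ L} (x∉ ∷ L!) with p Fin.≟ x
  ... | yes refl = ≤-reflexive (cong suc (occ-∉ L (Allₚ.All¬⇒¬Any x∉)))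
  ... | no  _    = occ≤1 L!

  module _ {v p q r} (N : Nbr v p q r) where
    open Nbr N

    adj≡δ : ∀ x → ⟦ adj v x ⟧ ≡ (δ p x + δ q x) + δ r x
    adj≡δ x with adj v x in eq
    adj≡δ x | false = sym (cong₂ _+_ (cong₂ _+_ (δ-≢ (neq ~p)) (δ-≢ (neq ~q))) (δ-≢ (neq ~r)))
      where
      neq : ∀ {y} → v ~ y → y ≢ x
      neq v~x refl with () ← trans (sym v~x) eq
    adj≡δ x | true with only eq
    ... | inj₁ refl =
      sym (cong₂ _+_ (cong₂ _+_ (δ-refl x) (δ-≢ (≢-sym p≢q))) (δ-≢ (≢-sym p≢r)))
    ... | inj₂ (inj₁ refl) =
      sym (cong₂ _+_ (cong₂ _+_ (δ-≢ p≢q) (δ-refl x)) (δ-≢ (≢-sym q≢r)))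
    ... | inj₂ (inj₂ refl) =
      sym (cong₂ _+_ (cong₂ _+_ (δ-≢ p≢r) (δ-≢ q≢r)) (δ-refl x))

    -- Reduces degree counts to occurrences of three named vertices. Each occurs at most once in a
    -- duplicate-free list and at least once where it is a member, which yields all the bounds
    -- below.
    cnt≡occ : ∀ L → cnt v L ≡ (occ p L + occ q L) + occ r L
    cnt≡occ []      = refl
    cnt≡occ (x ∷ L) = trans (cong₂ _+_ (adj≡δ x) (cnt≡occ L)) (regroup (δ p x) (δ q x) (δ r x) _ _ _)
      where
      regroup : ∀ a b c d e f → ((a + b) + c) + ((d + e) + f) ≡ ((a + d) + (b + e)) + (c + f)
      regroup = solve-∀

    cnt≤3 : ∀ {L} → Unique L → cnt v L ≤ 3
    cnt≤3 {L} L! = subst (_≤ 3) (sym (cnt≡occ L)) (+-mono-≤ (+-mono-≤ (occ≤1 L!) (occ≤1 L!)) (occ≤1 L!))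

    3≤cnt : ∀ {L} → p ∈ₗ L → q ∈ₗ L → r ∈ₗ L → 3 ≤ cnt v L
    3≤cnt {L} p∈ q∈ r∈ =
      subst (3 ≤_) (sym (cnt≡occ L)) (+-mono-≤ (+-mono-≤ (occ-∈ p∈) (occ-∈ q∈)) (occ-∈ r∈))

    cnt≤1 : ∀ {L} → Unique L → p ∉ₗ L → q ∉ₗ L → cnt v L ≤ 1
    cnt≤1 {L} L! p∉ q∉ = subst (_≤ 1) (sym (cnt≡occ L))
      (+-mono-≤ (+-mono-≤ (≤-reflexive (occ-∉ L p∉)) (≤-reflexive (occ-∉ L q∉))) (occ≤1 L!))

    cnt≤0 : ∀ {L} → p ∉ₗ L → q ∉ₗ L → r ∉ₗ L → cnt v L ≤ 0
    cnt≤0 {L} p∉ q∉ r∉ = ≤-reflexive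
      (trans (cnt≡occ L) (cong₂ _+_ (cong₂ _+_ (occ-∉ L p∉) (occ-∉ L q∉)) (occ-∉ L r∉)))

    1≤cnt : ∀ {L} → r ∈ₗ L → 1 ≤ cnt v L
    1≤cnt {L} r∈ = subst (1 ≤_) (sym (cnt≡occ L)) (≤-trans (occ-∈ r∈) (m≤n+m _ (occ p L + occ q L)))

  -- Follows the path to its first step out of `W`. The relation is arbitrary so that paths avoiding
  -- a given edge are covered too.
  crossing : ∀ {R : Fin n → Fin n → Set} W {x v} → Star R x v → x ∈ₗ W → v ∉ₗ W →
             ∃[ u ] ∃[ w ] R u w × u ∈ₗ W × w ∉ₗ W
  crossing W ε x∈ x∉ = ⊥-elim (x∉ x∈)
  crossing W (_◅_ {j = y} x→y y→v) x∈ v∉ with y ∈? W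
  ... | yes y∈ = crossing W y→v y∈ v∉
  ... | no  y∉ = _ , _ , x→y , x∈ , y∉

  Forced-mono : ∀ {S T v} → S ⊆ T → Forced G S v → Forced G T v
  Forced-mono S⊆T (init v∈S)      = init (S⊆T v∈S)
  Forced-mono S⊆T (force fu uw fx) = force (Forced-mono S⊆T fu) uw (λ x ux x≢w → Forced-mono S⊆T (fx x ux x≢w))

  force₃ : ∀ {S v p q r} → Nbr v p q r → Forced G S v → Forced G S p → Forced G S q → Forced G S r
  force₃ {S} {v} {p} {q} {r} N fv fp fq = force fv (Nbr.~r N) λ x v~x x≢r → others x≢r (Nbr.only N v~x)
    where
    others : ∀ {x} → x ≢ r → x ≡ p ⊎ x ≡ q ⊎ x ≡ r → Forced G S x
    others x≢r (inj₁ refl)        = fp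
    others x≢r (inj₂ (inj₁ refl)) = fq
    others x≢r (inj₂ (inj₂ x≡r)) = ⊥-elim (x≢r x≡r)

-- Triangles, diamonds and cliques in claw-free cubic graphs.

module Units (G : Graph) (claw-free : ClawFree G) (cubic : Cubic G) where
  open Graph G renaming (sym to adj-sym)
  open import Data.List.Membership.DecPropositional (Fin._≟_ {n}) using (_∈?_)
  open Neighbourhoods G

  -- Primes mark outer neighbours. Two equal ones would put a second triangle on an edge of this
  -- one, so their distinctness separates this unit from diamonds and K₄.
  record Triangle (a b c a′ b′ c′ : Fin n) : Set where
    field
      Na    : Nbr a b c a′
      Nb    : Nbr b a c b′
      Nc    : Nbr c a b c′
      a′≢b′ : a′ ≢ b′
      a′≢c′ : a′ ≢ c′
      b′≢c′ : b′ ≢ c′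

  -- The ends are `a` and `d`, the middle vertices `b` and `c`. The last two fields encode that the
  -- ends are not adjacent.
  record Diamond (a b c d a′ d′ : Fin n) : Set where
    field
      Na   : Nbr a b c a′
      Nb   : Nbr b a c d
      Nc   : Nbr c a b d
      Nd   : Nbr d b c d′
      a′≢d : a′ ≢ d
      d′≢a : d′ ≢ a

  record Clique₄ (a b c d : Fin n) : Set where
    field
      Na : Nbr a b c d
      Nb : Nbr b a c d
      Nc : Nbr c a b d
      Nd : Nbr d a b c

  -- Up to symmetry only a diamond offers two positions for `v`, hence two constructors for it.
  data Unit (v : Fin n) : Set where
    clique₄ : ∀ {b c d}          → Clique₄ v b c d          → Unit v
    triangle : ∀ {b c a′ b′ c′}  → Triangle v b c a′ b′ c′  → Unit v
    end     : ∀ {b c d a′ d′}    → Diamond v b c d a′ d′    → Unit v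
    middle  : ∀ {a c d a′ d′}    → Diamond a v c d a′ d′    → Unit v

  nbr-triangle : ∀ v → ∃[ p ] ∃[ q ] ∃[ r ] (Nbr v p q r × p ~ q)
  nbr-triangle v with neighbours cubic v
  ... | p , q , r , Nv with claw-free v p q r (Nbr.~p Nv) (Nbr.~q Nv) (Nbr.~r Nv)
                                      (Nbr.p≢q Nv) (Nbr.p≢r Nv) (Nbr.q≢r Nv)
  ...   | inj₁ p~q        = p , q , r , Nv , p~q
  ...   | inj₂ (inj₁ p~r) = r , p , q , rotate (rotate Nv) , ~-sym p~r
  ...   | inj₂ (inj₂ q~r) = q , r , p , rotate Nv , q~r

  not-nbr : ∀ {v x p q r} → Nbr v p q r → x ≢ p → x ≢ q → x ≢ r → ¬ v ~ x
  not-nbr Nv x≢p x≢q x≢r v~x = [ x≢p , [ x≢q , x≢r ] ] (Nbr.only Nv v~x)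

  -- The edge from `b` to `c` has the common neighbours `a` and `d`. Since `d` is not the third
  -- neighbour of `a`, these two are not adjacent, so the four vertices induce a diamond and not K₄.
  shared-edge⇒diamond : ∀ {a b c d t} → Nbr b a c d → Nbr c a b d → Nbr a b c t → d ≢ t →
                        ∃[ a′ ] ∃[ d′ ] Diamond a b c d a′ d′
  shared-edge⇒diamond {a} {b} {c} {d} {t} Nb Nc Na d≢t with neighbours cubic d
  ... | _ , _ , _ , N₀ with focus₂ b c N₀ (~-sym (Nbr.~r Nb)) (~-sym (Nbr.~r Nc)) (~⇒≢ (Nbr.~q Nb))
  ...   | d′ , Nd = t , d′ , record { Na = Na; Nb = Nb; Nc = Nc; Nd = Nd; a′≢d = ≢-sym d≢t; d′≢a = d′≢a }
    where
    d′≢a : d′ ≢ a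
    d′≢a refl = not-nbr Na (~⇒≢ (Nbr.~p Nd)) (~⇒≢ (Nbr.~q Nd)) d≢t (~-sym (Nbr.~r Nd))

  -- In a triangle `v`, `p`, `q` let `r`, `s`, `t` be the respective third neighbours. If all three
  -- agree they complete K₄; if exactly two agree, the edge between their owners is the middle edge
  -- of a diamond; otherwise the triangle has distinct outer neighbours.
  unit : ∀ v → Unit v
  unit v with nbr-triangle v
  ... | p , q , r , Nv , p~q with neighbours cubic p | neighbours cubic q
  ...   | _ , _ , _ , N₁ | _ , _ , _ , N₂
    with focus₂ v q N₁ (~-sym (Nbr.~p Nv)) p~q (~⇒≢ (Nbr.~q Nv))
       | focus₂ v p N₂ (~-sym (Nbr.~q Nv)) (~-sym p~q) (~⇒≢ (Nbr.~p Nv))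
  ...   | s , Np | t , Nq with r Fin.≟ s | r Fin.≟ t | s Fin.≟ t
  ...     | yes refl | yes refl | _ with neighbours cubic r
  ...       | _ , _ , _ , N₃ = clique₄ (record { Na = Nv; Nb = Np; Nc = Nq; Nd =
                focus₃ v p q N₃ (~-sym (Nbr.~r Nv)) (~-sym (Nbr.~r Np)) (~-sym (Nbr.~r Nq))
                       (~⇒≢ (Nbr.~p Nv)) (~⇒≢ (Nbr.~q Nv)) (~⇒≢ p~q) })
  unit v | p , q , r , Nv , p~q | _ | _ | s , Np | t , Nq | yes refl | no r≢t | _
    with shared-edge⇒diamond (swap Nv) (swap Np) Nq r≢t
  ...       | _ , _ , D = middle D
  unit v | p , q , r , Nv , p~q | _ | _ | s , Np | t , Nq | no r≢s | yes refl | _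
    with shared-edge⇒diamond Nv (swap Nq) Np r≢s
  ...       | _ , _ , D = middle D
  unit v | p , q , r , Nv , p~q | _ | _ | s , Np | t , Nq | no r≢s | no r≢t | yes refl
    with shared-edge⇒diamond Np Nq Nv (≢-sym r≢s)
  ...       | _ , _ , D = end D
  unit v | p , q , r , Nv , p~q | _ | _ | s , Np | t , Nq | no r≢s | no r≢t | no s≢t =
    triangle (record { Na = Nv; Nb = Np; Nc = Nq; a′≢b′ = r≢s; a′≢c′ = r≢t; b′≢c′ = s≢t })

  -- Expresses that `X` is a union of whole units without listing them: every triangle that meets
  -- `X` lies in `X`.
  TriangleClosed : List (Fin n) → Set
  TriangleClosed X = ∀ {a b c} → a ~ b → a ~ c → b ~ c → a ∈ₗ X → b ∈ₗ X

  ∉-closed : ∀ {X a b c} → TriangleClosed X → a ~ b → a ~ c → b ~ c → a ∉ₗ X → b ∉ₗ X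
  ∉-closed tc a~b a~c b~c a∉ b∈ = a∉ (tc (~-sym a~b) b~c a~c b∈)

  closed-outer : ∀ {v p q r} → Nbr v p q r → ¬ r ~ p → ¬ r ~ q →
                 ∀ {x y} → v ~ x → v ~ y → x ~ y → x ≡ p ⊎ x ≡ q
  closed-outer Nv r≁p r≁q v~x v~y x~y with Nbr.only Nv v~x
  ... | inj₁ x≡p        = inj₁ x≡p
  ... | inj₂ (inj₁ x≡q) = inj₂ x≡q
  ... | inj₂ (inj₂ refl) with Nbr.only Nv v~y
  ...   | inj₁ refl        = ⊥-elim (r≁p x~y)
  ...   | inj₂ (inj₁ refl) = ⊥-elim (r≁q x~y)
  ...   | inj₂ (inj₂ refl) = ⊥-elim (~⇒≢ x~y refl)

  module _ {a b c a′ b′ c′} (T : Triangle a b c a′ b′ c′) where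
    open Triangle T

    swap₁₂ : Triangle b a c b′ a′ c′
    swap₁₂ = record { Na = Nb; Nb = Na; Nc = swap Nc; a′≢b′ = ≢-sym a′≢b′; a′≢c′ = b′≢c′; b′≢c′ = a′≢c′ }

    swap₂₃ : Triangle a c b a′ c′ b′
    swap₂₃ = record { Na = swap Na; Nb = Nc; Nc = Nb; a′≢b′ = a′≢c′; a′≢c′ = a′≢b′; b′≢c′ = ≢-sym b′≢c′ }

  triangle-outer : ∀ {a b c a′ b′ c′} → Triangle a b c a′ b′ c′ → ¬ a′ ~ b
  triangle-outer T a′~b = not-nbr Nb (≢-sym (~⇒≢ (Nbr.~r Na))) (≢-sym (Nbr.q≢r Na)) a′≢b′ (~-sym a′~b)
    where open Triangle T

  closed-at : ∀ {a b c a′ b′ c′} → Triangle a b c a′ b′ c′ →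
              ∀ {x y} → a ~ x → a ~ y → x ~ y → x ≡ b ⊎ x ≡ c
  closed-at T = closed-outer (Triangle.Na T) (triangle-outer T) (triangle-outer (swap₂₃ T))

  closed-triangle : ∀ {a b c a′ b′ c′ X} → Triangle a b c a′ b′ c′ → TriangleClosed X →
                    TriangleClosed (a ∷ b ∷ c ∷ X)
  closed-triangle T tc a~x a~y x~y (here refl) =
    [ (λ { refl → there (here refl) }) , (λ { refl → there (there (here refl)) }) ] (closed-at T a~x a~y x~y)
  closed-triangle T tc a~x a~y x~y (there (here refl)) =
    [ (λ { refl → here refl }) , (λ { refl → there (there (here refl)) }) ] (closed-at (swap₁₂ T) a~x a~y x~y)
  closed-triangle T tc a~x a~y x~y (there (there (here refl))) =
    [ (λ { refl → here refl }) , (λ { refl → there (here refl) }) ] (closed-at (swap₁₂ (swap₂₃ T)) a~x a~y x~y)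
  closed-triangle T tc a~x a~y x~y (there (there (there v∈))) = there (there (there (tc a~x a~y x~y v∈)))

  module _ {a b c d a′ d′} (D : Diamond a b c d a′ d′) where
    open Diamond D

    reverse : Diamond d b c a d′ a′
    reverse = record { Na = Nd; Nb = swap (rotate Nb)
                     ; Nc = swap (rotate Nc); Nd = Na; a′≢d = d′≢a; d′≢a = a′≢d }

    closed-end : ∀ {x y} → a ~ x → a ~ y → x ~ y → x ≡ b ⊎ x ≡ c
    closed-end = closed-outer Na
      (λ e → not-nbr Nb (≢-sym (~⇒≢ (Nbr.~r Na))) (≢-sym (Nbr.q≢r Na)) a′≢d (~-sym e))
      (λ e → not-nbr Nc (≢-sym (~⇒≢ (Nbr.~r Na))) (≢-sym (Nbr.p≢r Na)) a′≢d (~-sym e))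

  closed-diamond : ∀ {a b c d a′ d′ X} → Diamond a b c d a′ d′ → TriangleClosed X →
                   TriangleClosed (a ∷ b ∷ c ∷ d ∷ X)
  closed-diamond D tc v~x v~y x~y (here refl) =
    [ (λ { refl → there (here refl) }) , (λ { refl → there (there (here refl)) }) ] (closed-end D v~x v~y x~y)
  closed-diamond D tc v~x v~y x~y (there (here refl)) with Nbr.only (Diamond.Nb D) v~x
  ... | inj₁ refl        = here refl
  ... | inj₂ (inj₁ refl) = there (there (here refl))
  ... | inj₂ (inj₂ refl) = there (there (there (here refl)))
  closed-diamond D tc v~x v~y x~y (there (there (here refl))) with Nbr.only (Diamond.Nc D) v~x
  ... | inj₁ refl        = here refl
  ... | inj₂ (inj₁ refl) = there (here refl)
  ... | inj₂ (inj₂ refl) = there (there (there (here refl)))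
  closed-diamond D tc v~x v~y x~y (there (there (there (here refl)))) =
    [ (λ { refl → there (here refl) }) , (λ { refl → there (there (here refl)) }) ] (closed-end (reverse D) v~x v~y x~y)
  closed-diamond D tc v~x v~y x~y (there (there (there (there v∈)))) =
    there (there (there (there (tc v~x v~y x~y v∈))))

  -- Edge counts inside units and degree sums.

  module _ {a b c a′ b′ c′} (T : Triangle a b c a′ b′ c′) where
    open Triangle T

    I-triangle : I (a ∷ b ∷ c ∷ []) ≡ 6
    I-triangle
      rewrite irrefl a | irrefl b | irrefl c
            | Nbr.~p Na | Nbr.~q Na | Nbr.~p Nb | Nbr.~q Nb | Nbr.~p Nc | Nbr.~q Nc = refl

  module _ {a b c d a′ d′} (D : Diamond a b c d a′ d′) where
    open Diamond D

    I-diamond : I (a ∷ b ∷ c ∷ d ∷ []) ≡ 10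
    I-diamond
      rewrite irrefl a | irrefl b | irrefl c | irrefl d
            | Nbr.~p Na | Nbr.~q Na | Nbr.~p Nb | Nbr.~q Nb | Nbr.~r Nb | Nbr.~p Nc | Nbr.~q Nc | Nbr.~r Nc
            | Nbr.~p Nd | Nbr.~q Nd
            -- The two ends are the only non-adjacent pair: 12 ordered pairs minus 2.
            | ¬-not (not-nbr Na (≢-sym (~⇒≢ (Nbr.~r Nb))) (≢-sym (~⇒≢ (Nbr.~r Nc))) (≢-sym a′≢d))
            | ¬-not (not-nbr Nd (~⇒≢ (Nbr.~p Na)) (~⇒≢ (Nbr.~q Na)) (≢-sym d′≢a)) = refl

  module _ {a b c d} (K : Clique₄ a b c d) where
    open Clique₄ K

    I-clique₄ : I (a ∷ b ∷ c ∷ d ∷ []) ≡ 12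
    I-clique₄
      rewrite irrefl a | irrefl b | irrefl c | irrefl d
            | Nbr.~p Na | Nbr.~q Na | Nbr.~r Na | Nbr.~p Nb | Nbr.~q Nb | Nbr.~r Nb
            | Nbr.~p Nc | Nbr.~q Nc | Nbr.~r Nc | Nbr.~p Nd | Nbr.~q Nd | Nbr.~r Nd = refl

  E≤3* : ∀ W {M} → Unique M → E W M ≤ 3 * length W
  E≤3* []      M! = z≤n
  E≤3* (w ∷ W) M! with neighbours cubic w
  ... | _ , _ , _ , Nw = ≤-trans (+-mono-≤ (cnt≤3 Nw M!) (E≤3* W M!)) (≤-reflexive (sym (*-suc 3 (length W))))

  3*≤E : ∀ W {M} → (∀ v → v ∈ₗ M) → 3 * length W ≤ E W M
  3*≤E []      all = z≤n
  3*≤E (w ∷ W) all with neighbours cubic w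
  ... | p , q , r , Nw = ≤-trans (≤-reflexive (*-suc 3 (length W)))
                                 (+-mono-≤ (3≤cnt Nw (all p) (all q) (all r)) (3*≤E W all))

  1≤cnt′ : ∀ {u v W} → u ∈ₗ W → v ~ u → 1 ≤ cnt v W
  1≤cnt′ {v = v} u∈ v~u with neighbours cubic v
  ... | _ , _ , _ , N₀ with focus _ N₀ v~u
  ...   | _ , _ , N₁ = 1≤cnt (rotate N₁) u∈

  2≤cnt : ∀ {u x v W} → u ∈ₗ W → x ∈ₗ W → v ~ u → v ~ x → u ≢ x → 2 ≤ cnt v W
  2≤cnt {v = v} {W} u∈ x∈ v~u v~x u≢x with neighbours cubic v
  ... | _ , _ , _ , N₀ with focus₂ _ _ N₀ v~u v~x u≢x
  ...   | _ , N₁ = subst (2 ≤_) (sym (cnt≡occ N₁ W)) (≤-trans (+-mono-≤ (occ-∈ u∈) (occ-∈ x∈)) (m≤m+n _ _))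

  -- The degree sum over `W` counts inner edges twice and outgoing edges once. If both outgoing
  -- edges end in the same vertex, it has two distinct neighbours in `W`; otherwise each outer
  -- endpoint contributes one.
  two-crossings : ∀ {W u v x y} → Unique W → u ~ v → x ~ y → u ∈ₗ W → x ∈ₗ W → v ∉ₗ W → y ∉ₗ W →
                  ¬ (x ≡ u × y ≡ v) → 2 + I W ≤ 3 * length W
  two-crossings {W} {u} {v} {x} {y} W! u~v x~y u∈ x∈ v∉ y∉ ≢ with y Fin.≟ v
  ... | yes refl = begin
    2 + I W           ≤⟨ +-monoˡ-≤ (I W) (2≤cnt u∈ x∈ (~-sym u~v) (~-sym x~y) (λ u≡x → ≢ (sym u≡x , refl))) ⟩
    cnt v W + I W     ≡⟨ sym (E-∷ʳ W v W) ⟩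
    E W (v ∷ W)       ≤⟨ E≤3* W (∉⇒All≢ v∉ ∷ W!) ⟩
    3 * length W      ∎
    where open ≤-Reasoning
  ... | no y≢v = begin
    1 + (1 + I W)               ≤⟨ +-mono-≤ (1≤cnt′ x∈ (~-sym x~y)) (+-monoˡ-≤ (I W) (1≤cnt′ u∈ (~-sym u~v))) ⟩
    cnt y W + (cnt v W + I W)   ≡⟨ cong (cnt y W +_) (sym (E-∷ʳ W v W)) ⟩
    cnt y W + E W (v ∷ W)       ≡⟨ sym (E-∷ʳ W y (v ∷ W)) ⟩
    E W (y ∷ v ∷ W)             ≤⟨ E≤3* W (∉⇒All≢ (y≢v ∉∷ y∉) ∷ ∉⇒All≢ v∉ ∷ W!) ⟩
    3 * length W                ∎
    where open ≤-Reasoning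

-- Growing the set of completed units under the potential bound.

potential-step : ∀ {s s′ k u e} l {i m} slack → s′ ≤ s + k → 4 * k + (u + (e + e)) ≤ 4 * l + slack →
                 4 * s + i ≤ 4 * m + 6 → 4 * s′ + ((u + (e + e)) + i) ≤ 4 * (l + m) + (6 + slack)
potential-step {s} {s′} {k} {u} {e} l {i} {m} slack s′≤ local pot = begin
  4 * s′ + ((u + (e + e)) + i)               ≤⟨ +-monoˡ-≤ _ (*-monoʳ-≤ 4 s′≤) ⟩
  4 * (s + k) + ((u + (e + e)) + i)          ≡⟨ regroup₁ s k (u + (e + e)) i ⟩
  (4 * k + (u + (e + e))) + (4 * s + i)      ≤⟨ +-mono-≤ local pot ⟩
  (4 * l + slack) + (4 * m + 6)              ≡⟨ regroup₂ l slack m ⟩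
  4 * (l + m) + (6 + slack)                  ∎
  where
  open ≤-Reasoning
  regroup₁ : ∀ s k x i → 4 * (s + k) + (x + i) ≡ (4 * k + x) + (4 * s + i)
  regroup₁ = solve-∀
  regroup₂ : ∀ l t m → (4 * l + t) + (4 * m + 6) ≡ 4 * (l + m) + (6 + t)
  regroup₂ = solve-∀

-- Runs as a refutation: `no-small` denies the bound, so every branch of the construction only has
-- to reach `⊥`, and "this unit can be added" becomes "this configuration is impossible".
module Search (G : Graph) (2-edge-connected : TwoEdgeConnected G) (claw-free : ClawFree G) (cubic : Cubic G)
              (no-small : ∀ S → IsZFS G S → ¬ 4 * ∣ S ∣ ≤ Graph.n G + 8) where
  open Graph G renaming (sym to adj-sym)
  open import Data.List.Membership.DecPropositional (Fin._≟_ {n}) using (_∈?_)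
  open Neighbourhoods G
  open Units G claw-free cubic

  -- When `X` is everything, the degree sum gives `3 * length X ≤ I X`; cancelling leaves
  -- `4 * ∣ S ∣ ≤ length X + 8`. The 8 is the usual 6 plus the loss of 2 allowed in the last step.
  finish : ∀ X S → Unique X → (∀ {v} → v ∈ₗ X → Forced G S v) →
           4 * ∣ S ∣ + I X ≤ 4 * length X + 8 → (∀ v → v ∈ₗ X) → ⊥
  finish X S X! blue pot all = no-small S (λ v → blue (all v))
    (≤-trans (+-cancelʳ-≤ (3 * length X) _ _ (begin
      4 * ∣ S ∣ + 3 * length X         ≤⟨ +-monoʳ-≤ (4 * ∣ S ∣) (3*≤E X all) ⟩
      4 * ∣ S ∣ + I X                  ≤⟨ pot ⟩
      4 * length X + 8                 ≡⟨ regroup (length X) ⟩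
      (length X + 8) + 3 * length X    ∎))
      (+-monoˡ-≤ 8 (unique⇒length≤n X!)))
    where
    open ≤-Reasoning
    regroup : ∀ l → 4 * l + 8 ≡ (l + 8) + 3 * l
    regroup = solve-∀

  -- X = L ++ Y is the set of completed units.  No diamond outside Y is attached to Y; L is the
  -- part grown since Y was last saturated, and `exits` says that at most 3 edges leave L.
  record State (Y L : List (Fin n)) (S : Subset n) : Set where
    field
      unique    : Unique (L ++ Y)
      closed    : TriangleClosed (L ++ Y)
      blue      : ∀ {v} → v ∈ₗ L ++ Y → Forced G S v
      potential : 4 * ∣ S ∣ + I (L ++ Y) ≤ 4 * length (L ++ Y) + 6
      saturated : ∀ {a b c d a′ d′} → Diamond a b c d a′ d′ → a ∉ₗ Y → a′ ∉ₗ Y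
      exits     : 3 * length L ≤ I L + 3
      root      : ∃[ v ] v ∈ₗ L ++ Y

  -- A vertex of `X` lies in a triangle, and that triangle is blue; it therefore has at most one
  -- white neighbour and can force it. Vertices just outside `X` come for free.
  blue-nbr : ∀ {X S x y} → TriangleClosed X → (∀ {v} → v ∈ₗ X → Forced G S v) → x ∈ₗ X → x ~ y → Forced G S y
  blue-nbr {x = x} tc blue x∈ x~y with nbr-triangle x
  ... | p , q , r , Nx , p~q with tc (Nbr.~p Nx) (Nbr.~q Nx) p~q x∈ | tc (Nbr.~q Nx) (Nbr.~p Nx) (~-sym p~q) x∈
  ...   | p∈ | q∈ with Nbr.only Nx x~y
  ...     | inj₁ refl        = blue p∈
  ...     | inj₂ (inj₁ refl) = blue q∈
  ...     | inj₂ (inj₂ refl) = force₃ Nx (blue x∈) (blue p∈) (blue q∈)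

  -- A unit `U` pays for itself when 4 per vertex covers 4 per new element of the forcing set, its
  -- inner count, and 2 per edge to `X`. The excess `slack` is 0 except for a diamond closed up at
  -- both ends, where it is 2.
  potential-++ : ∀ U X (S S′ : Subset n) k {u e} slack → ∣ S′ ∣ ≤ ∣ S ∣ + k → I U ≡ u → E U X ≤ e →
                 4 * k + (u + (e + e)) ≤ 4 * length U + slack →
                 4 * ∣ S ∣ + I X ≤ 4 * length X + 6 →
                 4 * ∣ S′ ∣ + I (U ++ X) ≤ 4 * (length U + length X) + (6 + slack)
  potential-++ U X S S′ k {e = e} slack size refl E≤e local pot =
    subst (λ i → 4 * ∣ S′ ∣ + i ≤ 4 * (length U + length X) + (6 + slack)) (sym (I-++ U X))
      (potential-step {∣ S ∣} {∣ S′ ∣} {k} {I U} {E U X} (length U) {I X} {length X} slack size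
        (≤-trans (+-monoʳ-≤ (4 * k) (+-monoʳ-≤ (I U) (+-mono-≤ E≤e E≤e))) local) pot)

  -- A joining edge leaves both parts before the union and neither afterwards, so it removes 2 from
  -- the total of outgoing edges: 2 + 3 - 2 = 3.
  exits-++ : ∀ U L {u} → I U ≡ u → 3 * length U ≤ u + 2 → 1 ≤ E U L → 3 * length L ≤ I L + 3 →
             3 * (length U + length L) ≤ I (U ++ L) + 3
  exits-++ U L refl U≤ 1≤E L≤ = begin
    3 * (length U + length L)              ≡⟨ *-distribˡ-+ 3 (length U) (length L) ⟩
    3 * length U + 3 * length L            ≤⟨ +-mono-≤ U≤ L≤ ⟩
    (I U + 2) + (I L + 3)                  ≤⟨ +-monoˡ-≤ (I L + 3) (+-monoʳ-≤ (I U) (+-mono-≤ 1≤E 1≤E)) ⟩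
    (I U + (E U L + E U L)) + (I L + 3)    ≡⟨ sym (+-assoc _ (I L) 3) ⟩
    ((I U + (E U L + E U L)) + I L) + 3    ≡⟨ cong (_+ 3) (sym (I-++ U L)) ⟩
    I (U ++ L) + 3                         ∎
    where open ≤-Reasoning

  -- As before, but two joining edges leave 2 + 3 - 4 = 1.
  exits≤1-++ : ∀ U L {u} → I U ≡ u → 3 * length U ≤ u + 2 → 2 ≤ E U L → 3 * length L ≤ I L + 3 →
               3 * (length U + length L) ≤ I (U ++ L) + 1
  exits≤1-++ U L refl U≤ 2≤E L≤ = +-cancelʳ-≤ 2 _ _ (begin
    3 * (length U + length L) + 2              ≡⟨ cong (_+ 2) (*-distribˡ-+ 3 (length U) (length L)) ⟩
    3 * length U + 3 * length L + 2            ≤⟨ +-monoˡ-≤ 2 (+-mono-≤ U≤ L≤) ⟩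
    (I U + 2) + (I L + 3) + 2                  ≡⟨ regroup₁ (I U) (I L) ⟩
    ((I U + 4) + I L) + 3                      ≤⟨ +-monoˡ-≤ 3 (+-monoˡ-≤ (I L) (+-monoʳ-≤ (I U) (+-mono-≤ 2≤E 2≤E))) ⟩
    ((I U + (E U L + E U L)) + I L) + 3        ≡⟨ cong (_+ 3) (sym (I-++ U L)) ⟩
    I (U ++ L) + 3                             ≡⟨ sym (+-assoc (I (U ++ L)) 1 2) ⟩
    I (U ++ L) + 1 + 2                         ∎)
    where
    open ≤-Reasoning
    regroup₁ : ∀ u l → (u + 2) + (l + 3) + 2 ≡ ((u + 4) + l) + 3
    regroup₁ = solve-∀

  -- A set left by at most one edge is left by none, because that edge would be a bridge.
  bridgeless : ∀ {W v} → Unique W → v ∈ₗ W → 3 * length W ≤ I W + 1 → ∀ w → w ∈ₗ W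
  bridgeless {W} {v} W! v∈ one w with w ∈? W
  ... | yes w∈ = w∈
  ... | no w∉ with crossing W (proj₁ 2-edge-connected v w) v∈ w∉
  ...   | x , y , x~y , x∈ , y∉ with crossing W (proj₂ 2-edge-connected x y x~y x y) x∈ y∉
  ...     | x′ , y′ , (x′~y′ , ≢xy , _) , x′∈ , y′∉ =
    ⊥-elim (<-irrefl refl (≤-trans (two-crossings W! x~y x′~y′ x∈ x′∈ y∉ y′∉ ≢xy)
                                   (≤-trans one (≤-reflexive (+-comm (I W) 1)))))

  fuel : ∀ k {m} l → n < suc k + m → n < k + (suc l + m)
  fuel k {m} l n<k = ≤-trans n<k (≤-trans (≤-reflexive (sym (+-suc k m))) (+-monoʳ-≤ k (s≤s (m≤n+m m l))))

  -- The fuel `k` cannot run out, since each call lengthens a duplicate-free list of vertices. If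
  -- `X` missed a vertex, some edge would leave `X`, and adding the unit at its far end leads to `⊥`
  -- by recursion or by `finish`; so `X` is everything.
  grow : ∀ k {Y L S} → State Y L S → n < k + length (L ++ Y) → ⊥
  grow zero    st n< = <-irrefl refl (≤-trans n< (unique⇒length≤n (State.unique st)))
  grow (suc k) {Y} {L} {S} st n< =
    finish X S unique blue (≤-trans potential (+-monoʳ-≤ (4 * length X) (m≤m+n 6 2))) all
    where
    open State st
    X = L ++ Y

    bluen : ∀ {x y} → x ∈ₗ X → x ~ y → Forced G S y
    bluen = blue-nbr closed blue

    -- The end `a` is forced from `a′`. With `b` added to the forcing set, `a` forces `c` and then
    -- `b` forces `d`. With one edge to `X` the balance is exact: 4 + 10 + 2 = 16.
    add-diamond : ∀ {a b c d a′ d′} → Diamond a b c d a′ d′ → a ∉ₗ X → a′ ∈ₗ X → ⊥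
    add-diamond {a} {b} {c} {d} {a′} {d′} D a∉ a′∈ = decide (d′ ∈? X)
      where
      open Diamond D
      S′ = S ∪ ⁅ b ⁆
      U = a ∷ b ∷ c ∷ d ∷ []

      S⇒S′ : ∀ {v} → Forced G S v → Forced G S′ v
      S⇒S′ = Forced-mono (p⊆p∪q ⁅ b ⁆)

      b∉ : b ∉ₗ X
      b∉ = ∉-closed closed (Nbr.~p Na) (Nbr.~q Na) (Nbr.~q Nb) a∉

      c∉ : c ∉ₗ X
      c∉ = ∉-closed closed (Nbr.~q Na) (Nbr.~p Na) (Nbr.~q Nc) a∉

      d∉ : d ∉ₗ X
      d∉ = ∉-closed closed (Nbr.~r Nb) (Nbr.~q Nb) (Nbr.~q Nd) b∉

      a-blue = S⇒S′ (bluen a′∈ (~-sym (Nbr.~r Na)))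
      b-blue = init (q⊆p∪q S ⁅ b ⁆ (x∈⁅x⁆ b))
      c-blue = force₃ (rotate (rotate Na)) a-blue (S⇒S′ (blue a′∈)) b-blue

      blue′ : ∀ {v} → v ∈ₗ U ++ X → Forced G S′ v
      blue′ (here refl)                         = a-blue
      blue′ (there (here refl))                 = b-blue
      blue′ (there (there (here refl)))         = c-blue
      blue′ (there (there (there (here refl)))) = force₃ Nb b-blue a-blue c-blue
      blue′ (there (there (there (there v∈)))) = S⇒S′ (blue v∈)

      prepend-unique : ∀ {Z} → (∀ {v} → v ∈ₗ Z → v ∈ₗ X) → Unique Z → Unique (U ++ Z)
      prepend-unique Z⊆X Z! =
        (~⇒≢ (Nbr.~p Na) ∷ ~⇒≢ (Nbr.~q Na) ∷ Nbr.p≢r Nb ∷ ∉⇒All≢ (a∉ ∘ Z⊆X)) ∷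
        (~⇒≢ (Nbr.~q Nb) ∷ ~⇒≢ (Nbr.~r Nb) ∷ ∉⇒All≢ (b∉ ∘ Z⊆X)) ∷
        (~⇒≢ (Nbr.~r Nc) ∷ ∉⇒All≢ (c∉ ∘ Z⊆X)) ∷ ∉⇒All≢ (d∉ ∘ Z⊆X) ∷ Z!

      a′∈L : a′ ∈ₗ L
      a′∈L = [ id , (λ a′∈Y → ⊥-elim (saturated D (a∉ ∘ ∈-++⁺ʳ L) a′∈Y)) ] (∈-++⁻ L a′∈)

      U-X≤ : ∀ {e} → cnt d X ≤ e → E U X ≤ 1 + e
      U-X≤ {e} d≤ = +-mono-≤ (cnt≤1 Na unique b∉ c∉)
        (+-mono-≤ (cnt≤0 Nb a∉ c∉ d∉) (+-mono-≤ (cnt≤0 Nc a∉ b∉ d∉)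
          (≤-trans (≤-reflexive (+-identityʳ (cnt d X))) d≤)))

      1≤E : 1 ≤ E U L
      1≤E = ≤-trans (1≤cnt Na a′∈L) (m≤m+n _ _)

      decide : Dec (d′ ∈ₗ X) → ⊥
      decide (no d′∉) = grow k {Y} {U ++ L} {S′} (record
        { unique    = prepend-unique id unique
        ; closed    = closed-diamond D closed
        ; blue      = blue′
        ; potential = potential-++ U X S S′ 1 0 (∣p∪⁅x⁆∣≤∣p∣+1 S b) (I-diamond D)
                                   (U-X≤ (cnt≤0 Nd b∉ c∉ d′∉)) ≤-refl potential
        ; saturated = saturated
        ; exits     = exits-++ U L (I-diamond D) ≤-refl 1≤E exits
        ; root      = a , here refl
        }) (fuel k 3 n<)
      -- With two edges to `X` the balance is 4 + 10 + 4 = 16 + 2. Since `Y` is saturated, both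
      -- attachments lie in `L`, so at most one edge leaves `U ++ L`; by `bridgeless` the process is
      -- over and the loss occurs only once.
      decide (yes d′∈) = finish (U ++ X) S′ (prepend-unique id unique) blue′
        (potential-++ U X S S′ 1 2 (∣p∪⁅x⁆∣≤∣p∣+1 S b) (I-diamond D)
                                   (U-X≤ (cnt≤1 Nd unique b∉ c∉)) ≤-refl potential)
        (λ v → ∈-++⁺ˡ (bridgeless (prepend-unique (∈-++⁺ˡ) (unique-++⁻ˡ L unique)) (here refl)
                            (exits≤1-++ U L (I-diamond D) ≤-refl 2≤E exits) v))
        where
        d′∈L : d′ ∈ₗ L
        d′∈L = [ id , (λ d′∈Y → ⊥-elim (saturated (reverse D) (d∉ ∘ ∈-++⁺ʳ L) d′∈Y)) ] (∈-++⁻ L d′∈)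

        2≤E : 2 ≤ E U L
        2≤E = +-mono-≤ (1≤cnt Na a′∈L) (≤-trans (≤-trans (1≤cnt Nd d′∈L) (m≤m+n _ 0))
                (≤-trans (m≤n+m _ (cnt c L)) (m≤n+m _ (cnt b L))))

    triangle-∉ : ∀ {a b c a′ b′ c′} → Triangle a b c a′ b′ c′ → a ∉ₗ X → b ∉ₗ X
    triangle-∉ T = ∉-closed closed (Nbr.~p Na) (Nbr.~q Na) (Nbr.~q Nb)
      where open Triangle T

    -- The allowance is 4 for each of the three vertices. It is met exactly by `s = 1`, `e = 1` and
    -- by `s = 0`, `e = 3`.
    add-triangle : ∀ {a b c a′ b′ c′ S′ e s} → Triangle a b c a′ b′ c′ → a ∉ₗ X →
                   (∀ {v} → v ∈ₗ X → Forced G S′ v) →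
                   Forced G S′ a → Forced G S′ b → Forced G S′ c → ∣ S′ ∣ ≤ ∣ S ∣ + s →
                   E (a ∷ b ∷ c ∷ []) X ≤ e → 4 * s + (6 + (e + e)) ≤ 12 → ⊥
    add-triangle {a} {b} {c} {S′ = S′} {s = s} T a∉ blue′ a-blue b-blue c-blue size E≤e local =
      grow k {X} {U} {S′} (record
        { unique    = (~⇒≢ (Nbr.~p Na) ∷ ~⇒≢ (Nbr.~q Na) ∷ ∉⇒All≢ a∉) ∷
                      (~⇒≢ (Nbr.~q Nb) ∷ ∉⇒All≢ b∉) ∷ ∉⇒All≢ c∉ ∷ unique
        ; closed    = closed-triangle T closed
        ; blue      = blue″
        ; potential = potential-++ U X S S′ s 0 size (I-triangle T) E≤e local potential
        -- Diamonds take precedence without any search: one attached to `X` is already refuted, so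
        -- `X` becomes the new saturated set and `L` restarts as the triangle with its three
        -- outgoing edges.
        ; saturated = add-diamond
        ; exits     = subst (λ i → 9 ≤ i + 3) (sym (I-triangle T)) ≤-refl
        ; root      = a , here refl
        }) (fuel k 2 n<)
      where
      open Triangle T
      U = a ∷ b ∷ c ∷ []

      b∉ = triangle-∉ T a∉
      c∉ = triangle-∉ (swap₂₃ T) a∉

      blue″ : ∀ {v} → v ∈ₗ U ++ X → Forced G S′ v
      blue″ (here refl)                 = a-blue
      blue″ (there (here refl))         = b-blue
      blue″ (there (there (here refl))) = c-blue
      blue″ (there (there (there v∈))) = blue′ v∈

    -- Both `a` and `b` are forced from outside, and then `a` forces `c`. Nothing is paid, so even
    -- three edges to `X` are affordable.
    add-triangle₂ : ∀ {a b c a′ b′ c′} → Triangle a b c a′ b′ c′ → a ∉ₗ X → a′ ∈ₗ X → b′ ∈ₗ X → ⊥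
    add-triangle₂ {a} {b} {c} T a∉ a′∈ b′∈ =
      add-triangle {S′ = S} {e = 3} {s = 0} T a∉ blue a-blue b-blue
        (force₃ (rotate (rotate Na)) a-blue (blue a′∈) b-blue)
        (m≤m+n _ 0)
        (+-mono-≤ (cnt≤1 Na unique b∉ c∉) (+-mono-≤ (cnt≤1 Nb unique a∉ c∉)
          (≤-trans (≤-reflexive (+-identityʳ (cnt c X))) (cnt≤1 Nc unique a∉ b∉)))) ≤-refl
      where
      open Triangle T
      a-blue = bluen a′∈ (~-sym (Nbr.~r Na))
      b-blue = bluen b′∈ (~-sym (Nbr.~r Nb))

      b∉ = triangle-∉ T a∉
      c∉ = triangle-∉ (swap₂₃ T) a∉

    enter-triangle : ∀ {a b c a′ b′ c′} → Triangle a b c a′ b′ c′ → a ∉ₗ X → a′ ∈ₗ X → ⊥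
    enter-triangle {a} {b} {c} {a′} {b′} {c′} T a∉ a′∈ with b′ ∈? X | c′ ∈? X
    ... | yes b′∈ | _       = add-triangle₂ T a∉ a′∈ b′∈
    ... | no _    | yes c′∈ = add-triangle₂ (swap₂₃ T) a∉ a′∈ c′∈
    -- Only `a` is attached: `b` is bought, and `a` then forces `c`.
    ... | no b′∉  | no c′∉  =
      add-triangle {S′ = S ∪ ⁅ b ⁆} {e = 1} {s = 1} T a∉ (S⇒S′ ∘ blue) a-blue b-blue
        (force₃ (rotate (rotate Na)) a-blue (S⇒S′ (blue a′∈)) b-blue) (∣p∪⁅x⁆∣≤∣p∣+1 S b)
        (+-mono-≤ (cnt≤1 Na unique b∉ c∉) (+-mono-≤ (cnt≤0 Nb a∉ c∉ b′∉)
          (≤-trans (≤-reflexive (+-identityʳ (cnt c X))) (cnt≤0 Nc a∉ b∉ c′∉)))) ≤-refl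
      where
      open Triangle T
      S⇒S′ : ∀ {v} → Forced G S v → Forced G (S ∪ ⁅ b ⁆) v
      S⇒S′ = Forced-mono (p⊆p∪q ⁅ b ⁆)

      a-blue = S⇒S′ (bluen a′∈ (~-sym (Nbr.~r Na)))
      b-blue = init (q⊆p∪q S ⁅ b ⁆ (x∈⁅x⁆ b))

      b∉ = triangle-∉ T a∉
      c∉ = triangle-∉ (swap₂₃ T) a∉

    -- No edge of a triangle crosses the boundary of `X`. This rules out K₄ and middle vertices, and
    -- leaves only edges to outer neighbours of triangles and diamond ends.
    stays : ∀ {x y z w} → x ∈ₗ X → y ∉ₗ X → y ~ w → z ~ w → y ~ z → x ≡ z → ⊥
    stays x∈ y∉ y~w z~w y~z refl = ∉-closed closed y~z y~w z~w y∉ x∈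

    enter : ∀ {x y} → Unit y → y ~ x → x ∈ₗ X → y ∉ₗ X → ⊥
    enter (clique₄ K) y~x x∈ y∉ =
      [ stays x∈ y∉ (Nbr.~q Na) (Nbr.~q Nb) (Nbr.~p Na)
      , [ stays x∈ y∉ (Nbr.~p Na) (Nbr.~q Nc) (Nbr.~q Na)
        , stays x∈ y∉ (Nbr.~p Na) (Nbr.~q Nd) (Nbr.~r Na) ] ] (Nbr.only Na y~x)
      where open Clique₄ K
    enter (triangle T) y~x x∈ y∉ =
      [ stays x∈ y∉ (Nbr.~q Na) (Nbr.~q Nb) (Nbr.~p Na)
      , [ stays x∈ y∉ (Nbr.~p Na) (Nbr.~q Nc) (Nbr.~q Na)
        , (λ { refl → enter-triangle T y∉ x∈ }) ] ] (Nbr.only Na y~x)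
      where open Triangle T
    enter (end D) y~x x∈ y∉ =
      [ stays x∈ y∉ (Nbr.~q Na) (Nbr.~q Nb) (Nbr.~p Na)
      , [ stays x∈ y∉ (Nbr.~p Na) (Nbr.~q Nc) (Nbr.~q Na)
        , (λ { refl → add-diamond D y∉ x∈ }) ] ] (Nbr.only Na y~x)
      where open Diamond D
    enter (middle D) y~x x∈ y∉ =
      [ stays x∈ y∉ (Nbr.~q Nb) (Nbr.~q Na) (Nbr.~p Nb)
      , [ stays x∈ y∉ (Nbr.~p Nb) (Nbr.~p Nc) (Nbr.~q Nb)
        , stays x∈ y∉ (Nbr.~q Nb) (Nbr.~q Nd) (Nbr.~r Nb) ] ] (Nbr.only Nb y~x)
      where open Diamond D

    all : ∀ v → v ∈ₗ X
    all v with v ∈? X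
    ... | yes v∈ = v∈
    ... | no v∉ with crossing X (proj₁ 2-edge-connected (proj₁ root) v) (proj₂ root) v∉
    ...   | x , y , x~y , x∈ , y∉ = ⊥-elim (enter (unit y) (~-sym x~y) x∈ y∉)

  -- The first unit.

  module Start {a b c d : Fin n} where
    S₀ : Subset n
    S₀ = (⁅ a ⁆ ∪ ⁅ b ⁆) ∪ ⁅ c ⁆

    ∣S₀∣≤3 : ∣ S₀ ∣ ≤ 3
    ∣S₀∣≤3 = ≤-trans (∣p∪⁅x⁆∣≤∣p∣+1 (⁅ a ⁆ ∪ ⁅ b ⁆) c)
      (+-monoˡ-≤ 1 (≤-trans (∣p∪⁅x⁆∣≤∣p∣+1 ⁅ a ⁆ b) (+-monoˡ-≤ 1 (≤-reflexive (∣⁅x⁆∣≡1 a)))))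

    a-blue : Forced G S₀ a
    a-blue = init (p⊆p∪q _ (p⊆p∪q _ (x∈⁅x⁆ a)))

    b-blue : Forced G S₀ b
    b-blue = init (p⊆p∪q _ (q⊆p∪q ⁅ a ⁆ _ (x∈⁅x⁆ b)))

    c-blue : Forced G S₀ c
    c-blue = init (q⊆p∪q (⁅ a ⁆ ∪ ⁅ b ⁆) _ (x∈⁅x⁆ c))

    four-blue : Nbr b a c d → ∀ {v} → v ∈ₗ a ∷ b ∷ c ∷ d ∷ [] → Forced G S₀ v
    four-blue Nb (here refl)                         = a-blue
    four-blue Nb (there (here refl))                 = b-blue
    four-blue Nb (there (there (here refl)))         = c-blue
    four-blue Nb (there (there (there (here refl)))) = force₃ Nb b-blue a-blue c-blue

    four-unique : Nbr b a c d → Nbr c a b d → a ≢ d → Unique (a ∷ b ∷ c ∷ d ∷ [])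
    four-unique Nb Nc a≢d = (≢-sym (~⇒≢ (Nbr.~p Nb)) ∷ Nbr.p≢q Nb ∷ a≢d ∷ []) ∷
                            (~⇒≢ (Nbr.~q Nb) ∷ ~⇒≢ (Nbr.~r Nb) ∷ []) ∷ (~⇒≢ (Nbr.~r Nc) ∷ []) ∷ [] ∷ []

    -- Three initial vertices cost 12. Triangle: 12 + 6 = 12 + 6; diamond: 12 + 10 = 16 + 6; K₄: 12
    -- + 12 = 16 + 8. This fixes the constant 6 of the potential.
    start-potential : ∀ U slack {u} → I U ≡ u → 12 + u ≤ 4 * length U + slack →
                      4 * ∣ S₀ ∣ + I U ≤ 4 * length U + slack
    start-potential U slack refl le = ≤-trans (+-monoˡ-≤ (I U) (*-monoʳ-≤ 4 ∣S₀∣≤3)) le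

  start-triangle : ∀ {a b c a′ b′ c′} → Triangle a b c a′ b′ c′ → ⊥
  start-triangle {a} {b} {c} T = grow (suc n) {[]} {a ∷ b ∷ c ∷ []} {S₀} (record
    { unique    = (~⇒≢ (Nbr.~p Na) ∷ ~⇒≢ (Nbr.~q Na) ∷ []) ∷ (~⇒≢ (Nbr.~q Nb) ∷ []) ∷ [] ∷ []
    ; closed    = closed-triangle T λ _ _ _ ()
    ; blue      = λ { (here refl) → a-blue ; (there (here refl)) → b-blue ; (there (there (here refl))) → c-blue }
    ; potential = start-potential (a ∷ b ∷ c ∷ []) 6 (I-triangle T) ≤-refl
    ; saturated = λ _ _ ()
    ; exits     = subst (λ i → 9 ≤ i + 3) (sym (I-triangle T)) ≤-refl
    ; root      = a , here refl
    }) (m≤m+n (suc n) _)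
    where
    open Triangle T
    open Start {a} {b} {c} {a}

  start-diamond : ∀ {a b c d a′ d′} → Diamond a b c d a′ d′ → ⊥
  start-diamond {a} {b} {c} {d} D = grow (suc n) {[]} {a ∷ b ∷ c ∷ d ∷ []} {S₀} (record
    { unique    = four-unique Nb Nc (Nbr.p≢r Nb)
    ; closed    = closed-diamond D λ _ _ _ ()
    ; blue      = four-blue Nb
    ; potential = start-potential (a ∷ b ∷ c ∷ d ∷ []) 6 (I-diamond D) ≤-refl
    ; saturated = λ _ _ ()
    ; exits     = subst (λ i → 12 ≤ i + 3) (sym (I-diamond D)) (m≤m+n 12 1)
    ; root      = a , here refl
    }) (m≤m+n (suc n) _)
    where
    open Diamond D
    open Start {a} {b} {c} {d}

  -- No edge leaves a K₄ in a cubic graph, so it is the whole graph and the larger constant 8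
  -- suffices at once.
  start-clique₄ : ∀ {a b c d} → Clique₄ a b c d → ⊥
  start-clique₄ {a} {b} {c} {d} K =
    finish (a ∷ b ∷ c ∷ d ∷ []) S₀ K! (four-blue Nb) (start-potential (a ∷ b ∷ c ∷ d ∷ []) 8 (I-clique₄ K) ≤-refl)
      (bridgeless K! (here refl) (subst (λ i → 12 ≤ i + 1) (sym (I-clique₄ K)) (m≤m+n 12 1)))
    where
    open Clique₄ K
    open Start {a} {b} {c} {d}
    K! = four-unique Nb Nc (~⇒≢ (Nbr.~r Na))

  start : ∀ {v} → Unit v → ⊥
  start (clique₄ K)  = start-clique₄ K
  start (triangle T) = start-triangle T
  start (end D)      = start-diamond D
  start (middle D)   = start-diamond D

-- Lower bound for rings of diamonds.

twin∈ : ∀ {G S} {x y : Fin (Graph.n G)} → Adj G x y →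
        (∀ {u} → Adj G u x → u ≢ y → Adj G u y) → (∀ {u} → Adj G u y → u ≢ x → Adj G u x) →
        IsLZFS G S → x ∈ S ⊎ y ∈ S
twin∈ {G} {S} {x} {y} x~y x⇒y y⇒x lzfs with x ∈ˢ? S | y ∈ˢ? S
... | yes x∈ | _      = inj₁ x∈
... | no _   | yes y∈ = inj₂ y∈
... | no x∉  | no y∉  = ⊥-elim (proj₁ (avoid (lzfs x)) refl)
  where
  open Neighbourhoods G

  x≢y : x ≢ y
  x≢y = ~⇒≢ x~y

  -- Neither twin can turn blue first: a vertex forcing one has the other as a second white
  -- neighbour, and the loop rule for one requires the other to be blue already.
  avoid : ∀ {v} → LForced G S v → v ≢ x × v ≢ y
  avoid (init v∈) = (λ { refl → x∉ v∈ }) , (λ { refl → y∉ v∈ })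
  avoid (force fu u~w others) =
    (λ { refl → proj₂ (avoid (others y (x⇒y u~w (proj₂ (avoid fu))) (≢-sym x≢y))) refl }) ,
    (λ { refl → proj₁ (avoid (others x (y⇒x u~w (proj₁ (avoid fu))) x≢y)) refl })
  avoid (loop nbrs) =
    (λ { refl → proj₂ (avoid (nbrs y x~y)) refl }) , (λ { refl → proj₁ (avoid (nbrs x (~-sym x~y))) refl })

DiamondEdge? : ∀ a b → Dec (DiamondEdge a b)
DiamondEdge? a b = ¬? (a Fin.≟ b) ×-dec ¬? (toℕ a ≟ 0 ×-dec toℕ b ≟ 1) ×-dec ¬? (toℕ a ≟ 1 ×-dec toℕ b ≟ 0)

module RingBound (G : Graph) {m : ℕ} (φ : Fin (Graph.n G) ↔ (Fin (2 + m) × Fin 4))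
                 (iso : ∀ u v → (Adj G u v → RingAdj (2 + m) (Inverse.to φ u) (Inverse.to φ v))
                              × (RingAdj (2 + m) (Inverse.to φ u) (Inverse.to φ v) → Adj G u v))
                 {S : Subset (Graph.n G)} (lzfs : IsLZFS G S) (small : ∣ S ∣ < 2 + (2 + m)) where
  open Inverse φ using (to; from)

  Vertex : Set
  Vertex = Fin (2 + m) × Fin 4

  _≟ᵥ_ : (p q : Vertex) → Dec (p ≡ q)
  _≟ᵥ_ = ≡-dec Fin._≟_ Fin._≟_

  to-from : ∀ p → to (from p) ≡ p
  to-from = Inverse.strictlyInverseˡ φ

  from-to : ∀ v → from (to v) ≡ v
  from-to = Inverse.strictlyInverseʳ φ

  from-injective : ∀ {p q} → from p ≡ from q → p ≡ q
  from-injective {p} {q} eq = trans (sym (to-from p)) (trans (cong to eq) (to-from q))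

  adj-from : ∀ {u r} → RingAdj (2 + m) (to u) r → Adj G u (from r)
  adj-from {u} {r} e = proj₂ (iso u (from r)) (subst (RingAdj (2 + m) (to u)) (sym (to-from r)) e)

  In : Vertex → Set
  In p = from p ∈ S

  inner : ∀ i a b → {True (DiamondEdge? a b)} → RingAdj (2 + m) (i , a) (i , b)
  inner i a b {e} = inj₁ (refl , toWitness e)

  -- Ring links touch only positions 0 and 1, so positions 2 and 3 have all their neighbours inside
  -- the diamond.
  twins : ∀ p i → (RingAdj (2 + m) p (i , 2F) → p ≢ (i , 3F) → RingAdj (2 + m) p (i , 3F))
                × (RingAdj (2 + m) p (i , 3F) → p ≢ (i , 2F) → RingAdj (2 + m) p (i , 2F))
  twins p i = (λ { (inj₁ (refl , e)) p≢ → inj₁ (refl , 2⇒3 _ e (p≢ ∘ cong (i ,_)))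
                 ; (inj₂ (inj₁ (_ , _ , ()))) ; (inj₂ (inj₂ (_ , () , _))) })
            , (λ { (inj₁ (refl , e)) p≢ → inj₁ (refl , 3⇒2 _ e (p≢ ∘ cong (i ,_)))
                 ; (inj₂ (inj₁ (_ , _ , ()))) ; (inj₂ (inj₂ (_ , () , _))) })
    where
    2⇒3 : ∀ x → DiamondEdge x 2F → x ≢ 3F → DiamondEdge x 3F
    2⇒3 0F _ _         = toWitness {a? = DiamondEdge? 0F 3F} tt
    2⇒3 1F _ _         = toWitness {a? = DiamondEdge? 1F 3F} tt
    2⇒3 2F (2≢2 , _) _ = ⊥-elim (2≢2 refl)
    2⇒3 3F _ 3≢3       = ⊥-elim (3≢3 refl)

    3⇒2 : ∀ x → DiamondEdge x 3F → x ≢ 2F → DiamondEdge x 2F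
    3⇒2 0F _ _         = toWitness {a? = DiamondEdge? 0F 2F} tt
    3⇒2 1F _ _         = toWitness {a? = DiamondEdge? 1F 2F} tt
    3⇒2 2F _ 2≢2       = ⊥-elim (2≢2 refl)
    3⇒2 3F (3≢3 , _) _ = ⊥-elim (3≢3 refl)

  lift-twin : ∀ {q r} → (∀ p → RingAdj (2 + m) p q → p ≢ r → RingAdj (2 + m) p r) →
              ∀ {u} → Adj G u (from q) → u ≢ from r → Adj G u (from r)
  lift-twin {q} {r} twin {u} u~q u≢r = adj-from
    (twin (to u) (subst (RingAdj (2 + m) (to u)) (to-from q) (proj₁ (iso u (from q)) u~q))
          (λ to-u≡r → u≢r (trans (sym (from-to u)) (cong from to-u≡r))))

  middle∈ : ∀ i → ∃ λ t → t ≢ 0F × t ≢ 1F × In (i , t)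
  middle∈ i with twin∈ {G} {S}
    (adj-from (subst (λ p → RingAdj (2 + m) p (i , 3F)) (sym (to-from (i , 2F))) (inner i 2F 3F)))
    (lift-twin λ p → proj₁ (twins p i)) (lift-twin λ p → proj₂ (twins p i)) lzfs
  ... | inj₁ 2∈ = 2F , (λ ()) , (λ ()) , 2∈
  ... | inj₂ 3∈ = 3F , (λ ()) , (λ ()) , 3∈

  t : Fin (2 + m) → Fin 4
  t i = proj₁ (middle∈ i)

  -- The vertices (i , t i) already use up 2 + m of the at most 3 + m elements of S.
  one-extra : ∀ {i j x y} → In (i , x) → x ≢ t i → In (j , y) → y ≢ t j → (i , x) ≡ (j , y)
  one-extra {i} {j} {x} {y} x∈ x≢t y∈ y≢t with (i , x) ≟ᵥ (j , y)
  ... | yes eq = eq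
  ... | no neq = ⊥-elim (<⇒≱ small (subst (λ l → 2 + l ≤ ∣ S ∣) (length-tabulate base)
    (unique⇒length≤∣p∣ ((neq ∘ from-injective {i , x} {j , y} ∷ fresh x≢t) ∷ fresh y≢t ∷
                         Uniqueₚ.tabulate⁺ base-injective)
                       (x∈ ∷ y∈ ∷ Allₚ.tabulate⁺ {f = base} λ l → proj₂ (proj₂ (proj₂ (middle∈ l)))))))
    where
    base : Fin (2 + m) → Fin (Graph.n G)
    base l = from (l , t l)

    base-injective : ∀ {l l′} → base l ≡ base l′ → l ≡ l′
    base-injective {l} {l′} eq = cong proj₁ (from-injective {l , t l} {l′ , t l′} eq)

    at : ∀ {l z l′} → (l , z) ≡ (l′ , t l′) → z ≡ t l
    at refl = refl

    fresh : ∀ {l z} → z ≢ t l → All (from (l , z) ≢_) (tabulate base)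
    fresh {l} {z} z≢t = Allₚ.tabulate⁺ {f = base} λ l′ eq →
      z≢t (at {l} {z} {l′} (from-injective {l , z} {l′ , t l′} eq))

  -- At most one of the three positions is `t i`; the other two would be two different extra
  -- elements.
  at-most-two : ∀ {i x y z} → x ≢ y → x ≢ z → y ≢ z → In (i , x) → In (i , y) → In (i , z) → ⊥
  at-most-two {i} {x} {y} {z} x≢y x≢z y≢z x∈ y∈ z∈ with x Fin.≟ t i | y Fin.≟ t i
  ... | yes refl | _        = y≢z (cong proj₂ (one-extra y∈ (≢-sym x≢y) z∈ (≢-sym x≢z)))
  ... | no x≢t   | yes refl = x≢z (cong proj₂ (one-extra x∈ x≢t z∈ (≢-sym y≢z)))
  ... | no x≢t   | no y≢t   = x≢y (cong proj₂ (one-extra x∈ x≢t y∈ y≢t))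

  extra : ∀ {i x y} → x ≢ y → In (i , x) → In (i , y) → ∃ λ z → In (i , z) × z ≢ t i
  extra {i} {x} x≢y x∈ y∈ with x Fin.≟ t i
  ... | yes refl = _ , y∈ , ≢-sym x≢y
  ... | no x≢t   = _ , x∈ , x≢t

  0≢t : ∀ i → 0F ≢ t i
  0≢t i = ≢-sym (proj₁ (proj₂ (middle∈ i)))

  1≢t : ∀ i → 1F ≢ t i
  1≢t i = ≢-sym (proj₁ (proj₂ (proj₂ (middle∈ i))))

  Next : Fin (2 + m) → Fin (2 + m) → Set
  Next i j = toℕ j ≡ suc (toℕ i) % (2 + m)

  -- Without wrap-around the index grows; with it, index `1 + m` is followed by 0. Having at least
  -- two diamonds is what makes these differ.
  Next⇒≢ : ∀ {i j} → Next i j → i ≢ j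
  Next⇒≢ {i} i→i refl with m≤n⇒m<n∨m≡n (Fin.toℕ<n i)
  ... | inj₁ 1+i<k = <⇒≢ (n<1+n (toℕ i)) (trans i→i (m<n⇒m%n≡m 1+i<k))
  ... | inj₂ 1+i≡k with () ←
    trans (sym (suc-injective 1+i≡k)) (trans i→i (trans (cong (_% (2 + m)) 1+i≡k) (n%n≡0 (2 + m))))

  next : ∀ i → ∃ λ j → Next i j
  next i = fromℕ< (m%n<n (suc (toℕ i)) (2 + m)) , Fin.toℕ-fromℕ< _

  previous : ∀ i → ∃ λ j → Next j i
  previous zero    = fromℕ (suc m) ,
    sym (trans (cong (λ j → suc j % (2 + m)) (Fin.toℕ-fromℕ (suc m))) (n%n≡0 (2 + m)))
  previous (suc i) = inject₁ i ,
    sym (trans (cong (λ j → suc j % (2 + m)) (Fin.toℕ-inject₁ i)) (m<n⇒m%n≡m (Fin.toℕ<n (suc i))))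

  -- Only `q` may fail `P`. The third vertex is kept apart because, at an end of a diamond, it is
  -- the one across the ring link.
  two-of-three : ∀ {P : Vertex → Set} q {r₁ r₂ r₃} → r₁ ≢ r₂ → r₁ ≢ r₃ → r₂ ≢ r₃ →
                 (r₁ ≢ q → P r₁) → (r₂ ≢ q → P r₂) → (r₃ ≢ q → P r₃) →
                 (P r₁ × P r₂) ⊎ (P r₁ ⊎ P r₂) × P r₃
  two-of-three q {r₁} {r₂} r₁≢r₂ r₁≢r₃ r₂≢r₃ p₁ p₂ p₃ with r₁ ≟ᵥ q | r₂ ≟ᵥ q
  ... | yes refl | _        = inj₂ (inj₂ (p₂ (≢-sym r₁≢r₂)) , p₃ (≢-sym r₁≢r₃))
  ... | no r₁≢q  | yes refl = inj₂ (inj₁ (p₁ r₁≢q) , p₃ (≢-sym r₂≢r₃))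
  ... | no r₁≢q  | no r₂≢q  = inj₁ (p₁ r₁≢q , p₂ r₂≢q)

  -- A force needs `p` and two of its neighbours in `S`. Three elements in one diamond are too many;
  -- otherwise `p` is an end, and it and the vertex across the link are extra elements in different
  -- diamonds.
  no-force : ∀ p q → In p → (∀ r → RingAdj (2 + m) p r → r ≢ q → In r) → ⊥
  no-force (i , 0F) q p∈ others with previous i
  ... | j , j→i with two-of-three {In} q {i , 2F} {i , 3F} {j , 1F} (λ ()) (λ ()) (λ ())
                       (others _ (inner i 0F 2F)) (others _ (inner i 0F 3F))
                       (others _ (inj₂ (inj₂ (j→i , refl , refl))))
  ...   | inj₁ (2∈ , 3∈) = at-most-two (λ ()) (λ ()) (λ ()) p∈ 2∈ 3∈
  ...   | inj₂ (_ , 1∈)  = Next⇒≢ j→i (cong proj₁ (one-extra 1∈ (1≢t j) p∈ (0≢t i)))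
  no-force (i , 1F) q p∈ others with next i
  ... | j , i→j with two-of-three {In} q {i , 2F} {i , 3F} {j , 0F} (λ ()) (λ ()) (λ ())
                       (others _ (inner i 1F 2F)) (others _ (inner i 1F 3F))
                       (others _ (inj₂ (inj₁ (i→j , refl , refl))))
  ...   | inj₁ (2∈ , 3∈) = at-most-two (λ ()) (λ ()) (λ ()) p∈ 2∈ 3∈
  ...   | inj₂ (_ , 0∈)  = Next⇒≢ i→j (cong proj₁ (one-extra p∈ (1≢t i) 0∈ (0≢t j)))
  no-force (i , 2F) q p∈ others with two-of-three {In} q {i , 0F} {i , 1F} {i , 3F} (λ ()) (λ ()) (λ ())
                                       (others _ (inner i 2F 0F)) (others _ (inner i 2F 1F))
                                       (others _ (inner i 2F 3F))
  ... | inj₁ (0∈ , 1∈)      = at-most-two (λ ()) (λ ()) (λ ()) p∈ 0∈ 1∈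
  ... | inj₂ (inj₁ 0∈ , 3∈) = at-most-two (λ ()) (λ ()) (λ ()) p∈ 0∈ 3∈
  ... | inj₂ (inj₂ 1∈ , 3∈) = at-most-two (λ ()) (λ ()) (λ ()) p∈ 1∈ 3∈
  no-force (i , 3F) q p∈ others with two-of-three {In} q {i , 0F} {i , 1F} {i , 2F} (λ ()) (λ ()) (λ ())
                                       (others _ (inner i 3F 0F)) (others _ (inner i 3F 1F))
                                       (others _ (inner i 3F 2F))
  ... | inj₁ (0∈ , 1∈)      = at-most-two (λ ()) (λ ()) (λ ()) p∈ 0∈ 1∈
  ... | inj₂ (inj₁ 0∈ , 2∈) = at-most-two (λ ()) (λ ()) (λ ()) p∈ 0∈ 2∈
  ... | inj₂ (inj₂ 1∈ , 2∈) = at-most-two (λ ()) (λ ()) (λ ()) p∈ 1∈ 2∈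

  -- A middle vertex has three neighbours in its own diamond. For an end, one of the two middle
  -- vertices is an extra element, and so is the vertex across the link.
  no-loop : ∀ p → (∀ r → RingAdj (2 + m) p r → In r) → ⊥
  no-loop (i , 0F) nbrs with previous i | extra (λ ()) (nbrs _ (inner i 0F 2F)) (nbrs _ (inner i 0F 3F))
  ... | j , j→i | _ , z∈ , z≢t =
    Next⇒≢ j→i (cong proj₁ (one-extra (nbrs _ (inj₂ (inj₂ (j→i , refl , refl)))) (1≢t j) z∈ z≢t))
  no-loop (i , 1F) nbrs with next i | extra (λ ()) (nbrs _ (inner i 1F 2F)) (nbrs _ (inner i 1F 3F))
  ... | j , i→j | _ , z∈ , z≢t =
    Next⇒≢ i→j (cong proj₁ (one-extra z∈ z≢t (nbrs _ (inj₂ (inj₁ (i→j , refl , refl)))) (0≢t j)))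
  no-loop (i , 2F) nbrs = at-most-two (λ ()) (λ ()) (λ ())
    (nbrs _ (inner i 2F 0F)) (nbrs _ (inner i 2F 1F)) (nbrs _ (inner i 2F 3F))
  no-loop (i , 3F) nbrs = at-most-two (λ ()) (λ ()) (λ ())
    (nbrs _ (inner i 3F 0F)) (nbrs _ (inner i 3F 1F)) (nbrs _ (inner i 3F 2F))

  -- Induction on the derivation: its premises are already in `S`, where neither rule can fire.
  stalled : ∀ {v} → LForced G S v → v ∈ S
  stalled (init v∈) = v∈
  stalled (force {u} {w} fu _ others) = ⊥-elim (
    no-force (to u) (to w) (subst (_∈ S) (sym (from-to u)) (stalled fu))
    λ r u~r r≢w → stalled (others (from r) (adj-from u~r) λ r≡w → r≢w (trans (sym (to-from r)) (cong to r≡w))))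
  stalled (loop {w} nbrs) = ⊥-elim (no-loop (to w) λ r w~r → stalled (nbrs (from r) (adj-from w~r)))

  contradiction : ⊥
  contradiction = at-most-two {0F} {0F} {1F} {2F} (λ ()) (λ ()) (λ ())
    (stalled (lzfs _)) (stalled (lzfs _)) (stalled (lzfs _))

-- Arithmetic and assembly of the two bounds.

n/4-bound⇒5n/18-bound : ∀ n z → z ≤ n → 4 * z ≤ n + 8 → z ≤ ⌈ 5 * n / 18 ⌉ + 1
n/4-bound⇒5n/18-bound n zero          _   _  = z≤n
n/4-bound⇒5n/18-bound n (suc y) 1+y≤n 4z≤ =
  subst (suc y ≤_) (+-comm 1 _) (s≤s (subst (_≤ (5 * n + 17) / 18) (m*n/n≡m y 18) (/-monoˡ-≤ 18 (18y≤ y 1+y≤n 4z≤))))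
  where
  open ≤-Reasoning
  -- The second hypothesis gives 5n + 17 ≥ 20y - 3, which is at least 18y once y ≥ 2. For y = 1 the
  -- first hypothesis supplies n ≥ 1.
  18y≤ : ∀ y → suc y ≤ n → 4 * suc y ≤ n + 8 → y * 18 ≤ 5 * n + 17
  18y≤ 0 _ _ = z≤n
  18y≤ 1 2≤n _ = +-monoˡ-≤ 17 (*-mono-≤ {1} {5} (s≤s z≤n) (≤-trans (s≤s z≤n) 2≤n))
  18y≤ (suc (suc w)) _ 4z≤ = +-cancelʳ-≤ 40 _ _ (begin
    (2 + w) * 18 + 40          ≤⟨ m≤m+n _ (1 + 2 * w) ⟩
    (2 + w) * 18 + 40 + (1 + 2 * w) ≡⟨ regroup₁ w ⟩
    5 * (4 * (3 + w)) + 17     ≤⟨ +-monoˡ-≤ 17 (*-monoʳ-≤ 5 4z≤) ⟩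
    5 * (n + 8) + 17           ≡⟨ regroup₂ n ⟩
    5 * n + 17 + 40            ∎)
    where
    regroup₁ : ∀ w → (2 + w) * 18 + 40 + (1 + 2 * w) ≡ 5 * (4 * (3 + w)) + 17
    regroup₁ = solve-∀
    regroup₂ : ∀ n → 5 * (n + 8) + 17 ≡ 5 * n + 17 + 40
    regroup₂ = solve-∀

Forced⇒LForced : ∀ {G S v} → Forced G S v → LForced G S v
Forced⇒LForced (init v∈)            = init v∈
Forced⇒LForced (force fu u~w others) =
  force (Forced⇒LForced fu) u~w (λ x u~x x≢w → Forced⇒LForced (others x u~x x≢w))

zl≤z : ∀ {G z zl} → IsZ G z → IsZl G zl → zl ≤ z
zl≤z ((S , refl , zfs) , _) (_ , zl-min) = zl-min S (λ v → Forced⇒LForced (zfs v))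

z≤n-vertices : ∀ {G z} → IsZ G z → z ≤ Graph.n G
z≤n-vertices {G} {z} (_ , z-min) = subst (z ≤_) (∣⊤∣≡n (Graph.n G)) (z-min ⊤ λ _ → init ∈⊤)

-- By minimality of z, failure of the bound for z means failure for every zero forcing set, which
-- `Search` refutes. A nonzero z also provides a vertex to start from.
4z≤n+8 : ∀ {G z} → TwoEdgeConnected G → ClawFree G → Cubic G → IsZ G z → 4 * z ≤ Graph.n G + 8
4z≤n+8 {G} {zero}  _   _  _     _     = z≤n
4z≤n+8 {G} {suc z} tec cf cubic Z@(_ , z-min) with 4 * suc z ≤? Graph.n G + 8
... | yes 4z≤ = 4z≤
... | no 4z≰  = ⊥-elim (Search.start G tec cf cubic
  (λ S zfs 4S≤ → 4z≰ (≤-trans (*-monoʳ-≤ 4 (z-min S zfs)) 4S≤))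
                          (Units.unit G cf cubic (fromℕ< (≤-trans (s≤s z≤n) (z≤n-vertices {G} Z)))))

theorem1p1 : (G : Graph) → TwoEdgeConnected G → ClawFree G → Cubic G →
    (z zl : ℕ) → IsZ G z → IsZl G zl →
    (¬ RingOfDiamonds G → zl ≤ z × z ≤ ⌈ 5 * Graph.n G / 18 ⌉ + 1)
    × (RingOfDiamonds G → zl ≡ z × z ≡ Graph.n G / 4 + 2)
theorem1p1 G tec cf cubic z zl Z Zl@((S , ∣S∣≡zl , lzfs) , _) =
  (λ _ → lz , n/4-bound⇒5n/18-bound (Graph.n G) z (z≤n-vertices {G} Z) 4z≤) , ring
  where
  lz : zl ≤ z
  lz = zl≤z {G} Z Zl

  4z≤ : 4 * z ≤ Graph.n G + 8
  4z≤ = 4z≤n+8 {G} tec cf cubic Z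

  ring : RingOfDiamonds G → zl ≡ z × z ≡ Graph.n G / 4 + 2
  ring (m , φ , iso) =
    -- The chain zl ≤ z ≤ k + 2 ≤ zl closes up: the middle step is `4z≤` with n = 4k, the last is
    -- the ring lower bound.
    ≤-antisym lz (≤-trans z≤ k+2≤zl) , trans (≤-antisym z≤ (≤-trans k+2≤zl lz)) k+2≡
    where
    k = 2 + m

    n≡k*4 : Graph.n G ≡ k * 4
    n≡k*4 = ↔⇒≡ (↔-sym (Fin.*↔× {k} {4}) ↔-∘ φ)

    k+2≡ : k + 2 ≡ Graph.n G / 4 + 2
    k+2≡ = cong (_+ 2) (sym (trans (cong (_/ 4) n≡k*4) (m*n/n≡m k 4)))

    z≤ : z ≤ k + 2
    z≤ = *-cancelˡ-≤ 4 (≤-trans 4z≤ (≤-reflexive (trans (cong (_+ 8) n≡k*4) (regroup k))))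
      where
      regroup : ∀ k → k * 4 + 8 ≡ 4 * (k + 2)
      regroup = solve-∀

    k+2≤zl : k + 2 ≤ zl
    k+2≤zl = subst₂ _≤_ (+-comm 2 k) ∣S∣≡zl (≮⇒≥ (λ small → RingBound.contradiction G φ iso lzfs small))
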